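{- Let $v\in(0,1)$. In the linear search model where the target can be detected only when the agent moves at speed $v$ (i.e. $p=0$), there exists no (deterministic) search algorithm with competitive ratio strictly smaller than $$3+2\sqrt{2+\frac{2}{v}}+\frac{2}{v}.$$
   Context: Search model (the case $p=0$): a stationary target is located at an unknown point $x$ of the real line with $|x|\ge 1$. The agent starts at the origin at time $0$. At any time it moves, in either direction, at speed $1$ or at the slower speed $v$. When the agent passes through (or reaches an endpoint of a slow move at) the target's location while moving at speed $v$, it detects the target with certainty; when moving at speed $1$ it never detects the target. A (deterministic) search algorithm is a trajectory $[0,\infty)\to\mathbb{R}$ starting at $0$, composed of successive straight moves, each made at speed $1$ or at speed $v$, with only finitely many moves in any bounded time interval; the agent follows it until the target is detected. Let $\tau(x)\in[0,\infty]$ be the first time at which a target at $x$ is detected ($\tau(x)=\infty$ if it is never detected). An omniscient agent needs time $|x|$ to reach the target (at speed $1$). The competitive ratio of the algorithm is $$\sup_{|x|\ge 1}\frac{\tau(x)}{|x|}.$$ -}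

module Defs where

open import Algebra.Bundles using (CommutativeRing)
open import Data.Empty using (⊥-elim)
open import Data.Nat.Base using (ℕ; suc)
open import Data.Product.Base using (∃; ∃-syntax; _×_; _,_; proj₁; proj₂)
open import Data.Sum.Base using (inj₁; inj₂)
open import Level using (0ℓ) renaming (suc to lsuc)
open import Relation.Binary.Bundles using (StrictTotalOrder)
open import Relation.Binary.Core using (Rel)
open import Relation.Binary.Definitions using (tri<; tri≈; tri>)
open import Relation.Binary.PropositionalEquality.Core using (_≡_)
open import Relation.Binary.Structures using (IsStrictTotalOrder)
open import Relation.Nullary.Construct.Add.Supremum using (_⁺; [_]; ⊤⁺)
open import Relation.Nullary.Negation.Core using (¬_)
open import Relation.Unary using (Pred)

import Relation.Binary.Construct.Add.Supremum.NonStrict as NonStrict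
import Relation.Binary.Construct.Add.Supremum.Strict as Strict
import Relation.Binary.Construct.StrictToNonStrict as ToNonStrict
import Relation.Binary.Reasoning.StrictPartialOrder as StrictReasoning

module _ {A : Set} (_≤_ : Rel A 0ℓ) where

  IsUpperBound : Pred A 0ℓ → Pred A 0ℓ
  IsUpperBound P b = ∀ x → P x → x ≤ b

  IsSupremum : Pred A 0ℓ → Pred A 0ℓ
  IsSupremum P s = IsUpperBound P s × (∀ b → IsUpperBound P b → s ≤ b)

-- The usual axiomatic description of the real numbers.

record CompleteOrderedField : Set (lsuc 0ℓ) where
  infix  4 _<_
  infix  8 _⁻¹
  infixl 7 _/_
  field
    commutativeRing : CommutativeRing 0ℓ 0ℓ

  open CommutativeRing commutativeRing public

  field
    _<_                : Rel Carrier 0ℓ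
    isStrictTotalOrder : IsStrictTotalOrder _≈_ _<_
    +-monoˡ-<          : ∀ z {x y} → x < y → x + z < y + z
    *-pos              : ∀ {x y} → 0# < x → 0# < y → 0# < x * y
    0<1                : 0# < 1#

    -- Total for convenience; the value of 0# ⁻¹ is unspecified.
    _⁻¹                : Carrier → Carrier
    ⁻¹-inverseʳ        : ∀ {x} → ¬ x ≈ 0# → x * x ⁻¹ ≈ 1#

  open ToNonStrict _≈_ _<_ public using (_≤_)

  field
    complete : (P : Pred Carrier 0ℓ) → ∃ P → ∃ (IsUpperBound _≤_ P) →
               ∃ (IsSupremum _≤_ P)

  strictTotalOrder : StrictTotalOrder 0ℓ 0ℓ 0ℓ
  strictTotalOrder = record { isStrictTotalOrder = isStrictTotalOrder }

  open IsStrictTotalOrder isStrictTotalOrder public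
    using (compare; <-resp-≈)
    renaming (trans to <-trans; irrefl to <-irrefl; asym to <-asym)

  _/_ : Carrier → Carrier → Carrier
  x / y = x * y ⁻¹

  2# : Carrier
  2# = 1# + 1#

  3# : Carrier
  3# = 2# + 1#

  ∣_∣ : Carrier → Carrier
  ∣ x ∣ with compare x 0#
  ... | tri< _ _ _ = - x
  ... | tri≈ _ _ _ = x
  ... | tri> _ _ _ = x

module SquareRoot (ℝ : CompleteOrderedField) where
  open CompleteOrderedField ℝ
  open StrictReasoning (StrictTotalOrder.strictPartialOrder strictTotalOrder)

  private
    ≮⇒≥ : ∀ {x y} → ¬ x < y → y ≤ x
    ≮⇒≥ {x} {y} x≮y with compare x y
    ... | tri< x<y _ _ = ⊥-elim (x≮y x<y)
    ... | tri≈ _ x≈y _ = inj₂ (sym x≈y)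
    ... | tri> _ _ y<x = inj₁ y<x

    ≤⇒≯ : ∀ {x y} → x ≤ y → ¬ y < x
    ≤⇒≯ (inj₁ x<y) y<x = <-asym x<y y<x
    ≤⇒≯ (inj₂ x≈y) y<x = <-irrefl (sym x≈y) y<x

    +-monoʳ-< : ∀ z {x y} → x < y → z + x < z + y
    +-monoʳ-< z {x} {y} x<y = begin-strict
      z + x  ≈⟨ +-comm z x ⟩
      x + z  <⟨ +-monoˡ-< z x<y ⟩
      y + z  ≈⟨ +-comm y z ⟩
      z + y  ∎

    +-monoˡ-≤ : ∀ z {x y} → x ≤ y → x + z ≤ y + z
    +-monoˡ-≤ z (inj₁ x<y) = inj₁ (+-monoˡ-< z x<y)
    +-monoˡ-≤ z (inj₂ x≈y) = inj₂ (+-congʳ x≈y)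

    +-monoʳ-≤ : ∀ z {x y} → x ≤ y → z + x ≤ z + y
    +-monoʳ-≤ z (inj₁ x<y) = inj₁ (+-monoʳ-< z x<y)
    +-monoʳ-≤ z (inj₂ x≈y) = inj₂ (+-congˡ x≈y)

    +-pos : ∀ {x y} → 0# ≤ x → 0# < y → 0# < x + y
    +-pos {x} {y} 0≤x 0<y = begin-strict
      0#      <⟨ 0<y ⟩
      y       ≈⟨ +-identityˡ y ⟨
      0# + y  ≤⟨ +-monoˡ-≤ y 0≤x ⟩
      x + y   ∎

    x+y-x≈y : ∀ x y → x + (y - x) ≈ y
    x+y-x≈y x y = begin-equality
      x + (y - x)    ≈⟨ +-congˡ (+-comm y (- x)) ⟩
      x + (- x + y)  ≈⟨ +-assoc x (- x) y ⟨
      x - x + y      ≈⟨ +-congʳ (-‿inverseʳ x) ⟩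
      0# + y         ≈⟨ +-identityˡ y ⟩
      y              ∎

    x<y⇒0<y-x : ∀ {x y} → x < y → 0# < y - x
    x<y⇒0<y-x {x} {y} x<y = begin-strict
      0#     ≈⟨ -‿inverseʳ x ⟨
      x - x  <⟨ +-monoˡ-< (- x) x<y ⟩
      y - x  ∎

    *-monoˡ-< : ∀ {z x y} → 0# < z → x < y → z * x < z * y
    *-monoˡ-< {z} {x} {y} 0<z x<y = begin-strict
      z * x                ≈⟨ +-identityʳ (z * x) ⟨
      z * x + 0#           <⟨ +-monoʳ-< (z * x) (*-pos 0<z (x<y⇒0<y-x x<y)) ⟩
      z * x + z * (y - x)  ≈⟨ distribˡ z x (y - x) ⟨
      z * (x + (y - x))    ≈⟨ *-congˡ (x+y-x≈y x y) ⟩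
      z * y                ∎

    *-monoˡ-≤ : ∀ {z x y} → 0# ≤ z → x ≤ y → z * x ≤ z * y
    *-monoˡ-≤ (inj₁ 0<z) (inj₁ x<y) = inj₁ (*-monoˡ-< 0<z x<y)
    *-monoˡ-≤ (inj₁ 0<z) (inj₂ x≈y) = inj₂ (*-congˡ x≈y)
    *-monoˡ-≤ {z} {x} {y} (inj₂ 0≈z) _ = inj₂ (begin-equality
      z * x   ≈⟨ *-congʳ 0≈z ⟨
      0# * x  ≈⟨ zeroˡ x ⟩
      0#      ≈⟨ zeroˡ y ⟨
      0# * y  ≈⟨ *-congʳ 0≈z ⟩
      z * y   ∎)

    *-monoʳ-≤ : ∀ {z x y} → 0# ≤ z → x ≤ y → x * z ≤ y * z
    *-monoʳ-≤ {z} {x} {y} 0≤z x≤y = begin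
      x * z  ≈⟨ *-comm x z ⟩
      z * x  ≤⟨ *-monoˡ-≤ 0≤z x≤y ⟩
      z * y  ≈⟨ *-comm z y ⟩
      y * z  ∎

    pos⇒≉0 : ∀ {x} → 0# < x → ¬ x ≈ 0#
    pos⇒≉0 0<x x≈0 = <-irrefl (sym x≈0) 0<x

    /-cancel : ∀ {x y} → 0# < y → y * (x / y) ≈ x
    /-cancel {x} {y} 0<y = begin-equality
      y * (x * y ⁻¹)  ≈⟨ *-congˡ (*-comm x (y ⁻¹)) ⟩
      y * (y ⁻¹ * x)  ≈⟨ *-assoc y (y ⁻¹) x ⟨
      y * y ⁻¹ * x    ≈⟨ *-congʳ (⁻¹-inverseʳ (pos⇒≉0 0<y)) ⟩
      1# * x          ≈⟨ *-identityˡ x ⟩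
      x               ∎

    /-pos : ∀ {x y} → 0# < x → 0# < y → 0# < x / y
    /-pos {x} {y} 0<x 0<y with compare 0# (x / y)
    ... | tri< 0<q _ _ = 0<q
    ... | tri≈ _ 0≈q _ = ⊥-elim (<-irrefl refl (begin-strict
      0#           <⟨ 0<x ⟩
      x            ≈⟨ /-cancel 0<y ⟨
      y * (x / y)  ≈⟨ *-congˡ 0≈q ⟨
      y * 0#       ≈⟨ zeroʳ y ⟩
      0#           ∎))
    ... | tri> _ _ q<0 = ⊥-elim (<-irrefl refl (begin-strict
      0#           <⟨ 0<x ⟩
      x            ≈⟨ /-cancel 0<y ⟨
      y * (x / y)  <⟨ *-monoˡ-< 0<y q<0 ⟩
      y * 0#       ≈⟨ zeroʳ y ⟩
      0#           ∎))

    squareOfSum : ∀ x y → (x + y) * (x + y) ≈ x * x + y * (x + x + y)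
    squareOfSum x y = begin-equality
      (x + y) * (x + y)                ≈⟨ distribʳ (x + y) x y ⟩
      x * (x + y) + y * (x + y)        ≈⟨ +-congʳ (distribˡ x x y) ⟩
      x * x + x * y + y * (x + y)      ≈⟨ +-assoc (x * x) (x * y) _ ⟩
      x * x + (x * y + y * (x + y))    ≈⟨ +-congˡ (+-congʳ (*-comm x y)) ⟩
      x * x + (y * x + y * (x + y))    ≈⟨ +-congˡ (distribˡ y x (x + y)) ⟨
      x * x + y * (x + (x + y))        ≈⟨ +-congˡ (*-congˡ (+-assoc x x y)) ⟨
      x * x + y * (x + x + y)          ∎

  sqrt : ∀ a → 0# ≤ a → ∃[ s ] (0# ≤ s × s * s ≈ a)
  sqrt a 0≤a = s , 0≤s , s²≈a
    where
    Below : Pred Carrier 0ℓ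
    Below y = 0# ≤ y × y * y ≤ a

    zero-below : Below 0#
    zero-below = inj₂ refl , (begin
      0# * 0#  ≈⟨ zeroˡ 0# ⟩
      0#       ≤⟨ 0≤a ⟩
      a        ∎)

    0<a+1 : 0# < a + 1#
    0<a+1 = +-pos 0≤a 0<1

    bound : IsUpperBound _≤_ Below (a + 1#)
    bound y (0≤y , y²≤a) = ≮⇒≥ λ a+1<y → <-irrefl refl (begin-strict
      a              ≈⟨ +-identityʳ a ⟨
      a + 0#         <⟨ +-monoʳ-< a 0<1 ⟩
      a + 1#         <⟨ a+1<y ⟩
      y              ≈⟨ *-identityʳ y ⟨
      y * 1#         ≈⟨ *-congˡ (+-identityˡ 1#) ⟨
      y * (0# + 1#)  ≤⟨ *-monoˡ-≤ 0≤y (+-monoˡ-≤ 1# 0≤a) ⟩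
      y * (a + 1#)   ≤⟨ *-monoˡ-≤ 0≤y (inj₁ a+1<y) ⟩
      y * y          ≤⟨ y²≤a ⟩
      a              ∎)

    supremum : ∃ (IsSupremum _≤_ Below)
    supremum = complete Below (0# , zero-below) (a + 1# , bound)

    s : Carrier
    s = proj₁ supremum

    isUpper : IsUpperBound _≤_ Below s
    isUpper = proj₁ (proj₂ supremum)

    isLeast : ∀ b → IsUpperBound _≤_ Below b → s ≤ b
    isLeast = proj₂ (proj₂ supremum)

    0≤s : 0# ≤ s
    0≤s = isUpper 0# zero-below

    s²≮a : ¬ s * s < a
    s²≮a s²<a = ≤⇒≯ (isUpper (s + ε) (inj₁ (+-pos 0≤s 0<ε) , inj₁ below)) (begin-strict
      s       ≈⟨ +-identityʳ s ⟨
      s + 0#  <⟨ +-monoʳ-< s 0<ε ⟩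
      s + ε   ∎)
      where
      d k ε : Carrier
      d = a - s * s
      k = s + s + 1#
      ε = d / (k + d)

      0<d : 0# < d
      0<d = x<y⇒0<y-x s²<a

      0<k : 0# < k
      0<k = begin-strict
        0#             <⟨ +-pos 0≤s (+-pos 0≤s 0<1) ⟩
        s + (s + 1#)   ≈⟨ +-assoc s s 1# ⟨
        k              ∎

      0<k+d : 0# < k + d
      0<k+d = +-pos (inj₁ 0<k) 0<d

      0<ε : 0# < ε
      0<ε = /-pos 0<d 0<k+d

      ε[k+d]≈d : ε * (k + d) ≈ d
      ε[k+d]≈d = trans (*-comm ε (k + d)) (/-cancel 0<k+d)

      1≰ε : ¬ 1# ≤ ε
      1≰ε 1≤ε = <-irrefl refl (begin-strict
        d             ≈⟨ +-identityˡ d ⟨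
        0# + d        <⟨ +-monoˡ-< d 0<k ⟩
        k + d         ≈⟨ *-identityˡ (k + d) ⟨
        1# * (k + d)  ≤⟨ *-monoʳ-≤ (inj₁ 0<k+d) 1≤ε ⟩
        ε * (k + d)   ≈⟨ ε[k+d]≈d ⟩
        d             ∎)

      ε<1 : ε < 1#
      ε<1 with compare ε 1#
      ... | tri< ε<1 _ _ = ε<1
      ... | tri≈ ε≮1 _ _ = ⊥-elim (1≰ε (≮⇒≥ ε≮1))
      ... | tri> ε≮1 _ _ = ⊥-elim (1≰ε (≮⇒≥ ε≮1))

      below : (s + ε) * (s + ε) < a
      below = begin-strict
        (s + ε) * (s + ε)        ≈⟨ squareOfSum s ε ⟩
        s * s + ε * (s + s + ε)  <⟨ +-monoʳ-< (s * s) (*-monoˡ-< 0<ε (+-monoʳ-< (s + s) ε<1)) ⟩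
        s * s + ε * k            ≈⟨ +-congˡ (*-congˡ (+-identityʳ k)) ⟨
        s * s + ε * (k + 0#)     <⟨ +-monoʳ-< (s * s) (*-monoˡ-< 0<ε (+-monoʳ-< k 0<d)) ⟩
        s * s + ε * (k + d)      ≈⟨ +-congˡ ε[k+d]≈d ⟩
        s * s + d                ≈⟨ x+y-x≈y (s * s) a ⟩
        a                        ∎

    s²≯a : ¬ a < s * s
    s²≯a a<s² = ≤⇒≯ (isLeast (s - δ) upper) s-δ<s
      where
      0<s : 0# < s
      0<s with 0≤s
      ... | inj₁ 0<s = 0<s
      ... | inj₂ 0≈s = ⊥-elim (<-irrefl refl (begin-strict
        0#      ≤⟨ 0≤a ⟩
        a       <⟨ a<s² ⟩
        s * s   ≈⟨ *-congʳ 0≈s ⟨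
        0# * s  ≈⟨ zeroˡ s ⟩
        0#      ∎))

      e δ : Carrier
      e = s * s - a
      δ = e / (s + s)

      0<s+s : 0# < s + s
      0<s+s = +-pos 0≤s 0<s

      0<δ : 0# < δ
      0<δ = /-pos (x<y⇒0<y-x a<s²) 0<s+s

      s-δ<s : s - δ < s
      s-δ<s = begin-strict
        s - δ             ≈⟨ +-identityʳ (s - δ) ⟨
        s - δ + 0#        <⟨ +-monoʳ-< (s - δ) 0<δ ⟩
        s - δ + δ         ≈⟨ +-comm (s - δ) δ ⟩
        δ + (s - δ)       ≈⟨ x+y-x≈y δ s ⟩
        s                 ∎

      upper : IsUpperBound _≤_ Below (s - δ)
      upper y (0≤y , y²≤a) = ≮⇒≥ λ s-δ<y → <-irrefl refl (begin-strict
        s * s                     <⟨ *-monoˡ-< 0<s (s<δ+y s-δ<y) ⟩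
        s * (δ + y)               ≈⟨ distribˡ s δ y ⟩
        s * δ + s * y             ≈⟨ +-congˡ (*-comm s y) ⟩
        s * δ + y * s             ≤⟨ +-monoʳ-≤ (s * δ) (*-monoˡ-≤ 0≤y (inj₁ (s<δ+y s-δ<y))) ⟩
        s * δ + y * (δ + y)       ≈⟨ +-congˡ (distribˡ y δ y) ⟩
        s * δ + (y * δ + y * y)   ≤⟨ +-monoʳ-≤ (s * δ) (+-monoˡ-≤ (y * y) (*-monoʳ-≤ (inj₁ 0<δ) (isUpper y (0≤y , y²≤a)))) ⟩
        s * δ + (s * δ + y * y)   ≈⟨ +-assoc (s * δ) (s * δ) (y * y) ⟨
        s * δ + s * δ + y * y     ≈⟨ +-congʳ (distribʳ δ s s) ⟨
        (s + s) * δ + y * y       ≈⟨ +-congʳ (/-cancel 0<s+s) ⟩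
        e + y * y                 ≤⟨ +-monoʳ-≤ e y²≤a ⟩
        e + a                     ≈⟨ +-comm e a ⟩
        a + e                     ≈⟨ x+y-x≈y a (s * s) ⟩
        s * s                     ∎)
        where
        s<δ+y : s - δ < y → s < δ + y
        s<δ+y s-δ<y = begin-strict
          s            ≈⟨ x+y-x≈y δ s ⟨
          δ + (s - δ)  <⟨ +-monoʳ-< δ s-δ<y ⟩
          δ + y        ∎

    s²≈a : s * s ≈ a
    s²≈a with compare (s * s) a
    ... | tri< s²<a _ _ = ⊥-elim (s²≮a s²<a)
    ... | tri≈ _ s²≈a _ = s²≈a
    ... | tri> _ _ a<s² = ⊥-elim (s²≯a a<s²)

  -- Extended by 0# to negative arguments.
  infix 9 √_
  √_ : Carrier → Carrier
  √ a with compare a 0#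
  ... | tri< _ _ _   = 0#
  ... | tri≈ _ a≈0 _ = proj₁ (sqrt a (inj₂ (sym a≈0)))
  ... | tri> _ _ 0<a = proj₁ (sqrt a (inj₁ 0<a))

  √-nonneg : ∀ a → 0# ≤ √ a
  √-nonneg a with compare a 0#
  ... | tri< _ _ _   = inj₂ refl
  ... | tri≈ _ a≈0 _ = proj₁ (proj₂ (sqrt a (inj₂ (sym a≈0))))
  ... | tri> _ _ 0<a = proj₁ (proj₂ (sqrt a (inj₁ 0<a)))

  √-square : ∀ {a} → 0# ≤ a → √ a * √ a ≈ a
  √-square {a} 0≤a with compare a 0#
  ... | tri< a<0 _ _ = ⊥-elim (≤⇒≯ 0≤a a<0)
  ... | tri≈ _ a≈0 _ = proj₂ (proj₂ (sqrt a (inj₂ (sym a≈0))))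
  ... | tri> _ _ 0<a = proj₂ (proj₂ (sqrt a (inj₁ 0<a)))

data Direction : Set where
  left right : Direction

data Speed : Set where
  fast slow : Speed

module LinearSearch (ℝ : CompleteOrderedField)
                    (v : CompleteOrderedField.Carrier ℝ) where
  open CompleteOrderedField ℝ

  open NonStrict _≤_ public using (_≤⁺_)
  open Strict    _<_ public using (_<⁺_)

  ℝ⁺ : Set
  ℝ⁺ = Carrier ⁺

  speedValue : Speed → Carrier
  speedValue fast = 1#
  speedValue slow = v

  velocity : Direction → Speed → Carrier
  velocity left  σ = - speedValue σ
  velocity right σ = speedValue σ

  -- The n-th move takes place during [ time n , time (suc n) ].  Only the
  -- values of position at nonnegative times are meaningful.
  record SearchAlgorithm : Set where
    field
      position        : Carrier → Carrier
      position-start  : position 0# ≈ 0#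
      time            : ℕ → Carrier
      time-start      : time 0 ≈ 0#
      time-increasing : ∀ n → time n < time (suc n)
      -- Only finitely many moves begin in a bounded time interval.
      time-unbounded  : ∀ t → ∃[ n ] t < time n
      direction       : ℕ → Direction
      speed           : ℕ → Speed
      move            : ∀ n t → time n ≤ t → t ≤ time (suc n) →
                        position t ≈ position (time n) +
                          velocity (direction n) (speed n) * (t - time n)

  module _ (A : SearchAlgorithm) where
    open SearchAlgorithm A

    -- Slow moves are closed segments: both endpoints are detected.
    DetectsAt : Carrier → Pred Carrier 0ℓ
    DetectsAt x t = ∃[ n ] (speed n ≡ slow × time n ≤ t × t ≤ time (suc n) ×
                            position t ≈ x)

    -- IsDetectionTime x T means τ(x) = T, with ⊤⁺ in the role of ∞.
    IsDetectionTime : Carrier → Pred ℝ⁺ 0ℓ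
    IsDetectionTime x [ t ] = DetectsAt x t × (∀ s → DetectsAt x s → t ≤ s)
    IsDetectionTime x ⊤⁺    = ∀ t → ¬ DetectsAt x t

    infixl 7 _/⁺_
    _/⁺_ : ℝ⁺ → Carrier → ℝ⁺
    [ t ] /⁺ y = [ t / y ]
    ⊤⁺    /⁺ y = ⊤⁺

    IsRatio : Pred ℝ⁺ 0ℓ
    IsRatio q = ∃[ x ] ∃[ T ] (1# ≤ ∣ x ∣ × IsDetectionTime x T × q ≡ T /⁺ ∣ x ∣)

    IsCompetitiveRatio : Pred ℝ⁺ 0ℓ
    IsCompetitiveRatio = IsSupremum _≤⁺_ IsRatio

{-# OPTIONS --safe #-}

-- Put w = 1/v and c = 1 + w, and suppose that every target x is found by time
-- r |x|.  Choose alternately on the two sides targets just beyond the part of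
-- the half-line detected so far; let s_n be the time at which the n-th of them
-- is found and y_n the extent of the detected part on its side when it was
-- chosen.  Between s_n and s_{n+1} the agent crosses [-y_{n+1}, y_n]
-- (suitably oriented).  A point entering this region only later is detected
-- during an excursion that returns to the same side of it, so it is crossed
-- twice, once of them slowly, which costs at least c.  Integrating over all
-- points, up to a constant,
--   Σ_{k<n} (y_k + y_{k+1}) + c (y_n + y_{n+1}) ≤ s_n ≤ r y_n.
-- In terms of the partial sums of y this is a linear recurrence whose
-- characteristic polynomial has no real root below the claimed bound, which is
-- incompatible with the sums being positive and increasing.

module Submission where

open import Defs
open import Axiom.ExcludedMiddle using (ExcludedMiddle)
open import Data.Product.Base using (∃-syntax; _×_)
open import Level using (0ℓ)
open import Relation.Nullary.Construct.Add.Supremum using ([_])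
open import Relation.Nullary.Negation.Core using (¬_)

open import Algebra.Solver.Ring.AlmostCommutativeRing
  using (AlmostCommutativeRing; fromCommutativeRing; _-Raw-AlmostCommutative⟶_)
open import Data.Empty using (⊥; ⊥-elim)
open import Data.List.Base using (List; []; _∷_; _++_)
open import Data.List.Membership.Propositional using (_∈_)
open import Data.List.Relation.Unary.All as All using (All; []; _∷_)
open import Data.List.Relation.Unary.Any using (here; there)
open import Data.Maybe.Base using (Maybe; just; nothing)
open import Data.Nat.Base as ℕ using (ℕ; zero; suc)
open import Data.Nat.Induction using (<-rec)
open import Data.Product.Base using (∃; _,_; proj₁; proj₂)
open import Data.Sum.Base as Sum using (_⊎_; inj₁; inj₂; swap)
open import Relation.Binary.Bundles using (StrictTotalOrder)
open import Relation.Binary.Definitions using (tri<; tri≈; tri>)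
open import Relation.Binary.PropositionalEquality.Core as ≡ using (_≡_)
open import Relation.Nullary.Construct.Add.Supremum using (⊤⁺)
open import Relation.Nullary.Decidable.Core using (yes; no; toSum; decidable-stable)
open import Relation.Unary using (Pred)

import Algebra.Properties.Monoid.Mult.TCOptimised as MonoidMult
import Algebra.Properties.Ring as RingProperties
import Algebra.Properties.Semiring.Mult.TCOptimised as SemiringMult
import Algebra.Solver.Ring as RingSolver
import Data.Integer.Base as ℤ
import Data.Integer.Properties as ℤ
import Data.List.Relation.Unary.All.Properties as All
import Data.Nat.Properties as ℕ
import Data.Sign.Base as Sign
import Relation.Binary.Construct.Add.Supremum.NonStrict as NonStrict
import Relation.Binary.Construct.Add.Supremum.Strict as Strict
import Relation.Binary.Reasoning.StrictPartialOrder as StrictReasoning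

-- The bound is the value of r at which c x² - (r - 1) x + (r + 1 - c) acquires a double root, x =
-- (c + σ) / c with σ² = 2c. No roots are computed, however: the slack below this value makes the
-- quotients of consecutive partial sums fall by a fixed amount at each step, although they stay
-- positive. Two obstacles keep the argument from being exact. The supremum of a detected stretch
-- may itself be detected, so the next target is only known to lie within a factor κ > 1 of it; as r
-- is strictly below the bound, κ can be taken with r κ still below it, and the recurrence is run
-- with r κ. Points of (-1, 1) are no targets and need never be crossed slowly; crediting each with
-- c produces the additive constant 2c, which disappears when the partial sums start at -c. Passing
-- a point costs the reciprocal of the speed per unit length, so elapsed time is the integral over
-- the line of the cost of all passages. All functions involved are step functions. Inequalities
-- between them are checked only off the finitely many endpoints, where each straight piece of
-- motion either passes a point completely or misses it.

-- Arithmetic and order in a complete ordered field.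

module OrderedField (ℝ : CompleteOrderedField) where
  open CompleteOrderedField ℝ
  module OrderReasoning = StrictReasoning (StrictTotalOrder.strictPartialOrder strictTotalOrder)
  open OrderReasoning

  -- Equality in the field is not decidable, so the ring solver takes its coefficients from the
  -- integers, through their canonical homomorphism.
  module IntegerCoefficients where
    open RingProperties ring using (-0#≈0#; -‿+-comm; -‿involutive; -‿distribˡ-*; -‿distribʳ-*)
    open MonoidMult +-monoid using (×-homo-+) renaming (_×_ to _×′_)
    open SemiringMult semiring using (×1-homo-*)

    ⟦_⟧ : ℤ.ℤ → Carrier
    ⟦ ℤ.+ n ⟧      = n ×′ 1#
    ⟦ ℤ.-[1+ n ] ⟧ = - (suc n ×′ 1#)

    suc-homo : ∀ n → suc n ×′ 1# ≈ 1# + n ×′ 1#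
    suc-homo n = ×-homo-+ 1# 1 n

    cancel : ∀ a b → a - b ≈ (1# + a) - (1# + b)
    cancel a b = begin-equality
      a - b                    ≈⟨ +-congʳ (+-identityˡ a) ⟨
      0# + a - b               ≈⟨ +-congʳ (+-congʳ (-‿inverseʳ 1#)) ⟨
      1# - 1# + a - b          ≈⟨ +-congʳ (+-assoc 1# (- 1#) a) ⟩
      1# + (- 1# + a) - b      ≈⟨ +-congʳ (+-congˡ (+-comm (- 1#) a)) ⟩
      1# + (a - 1#) - b        ≈⟨ +-congʳ (+-assoc 1# a (- 1#)) ⟨
      1# + a - 1# - b          ≈⟨ +-assoc (1# + a) (- 1#) (- b) ⟩
      1# + a + (- 1# - b)      ≈⟨ +-congˡ (-‿+-comm 1# b) ⟩
      (1# + a) - (1# + b)      ∎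

    ⊖-homo : ∀ m n → ⟦ m ℤ.⊖ n ⟧ ≈ m ×′ 1# - n ×′ 1#
    ⊖-homo zero    zero    = sym (-‿inverseʳ 0#)
    ⊖-homo zero    (suc n) = sym (+-identityˡ _)
    ⊖-homo (suc m) zero    = begin-equality
      suc m ×′ 1#       ≈⟨ +-identityʳ _ ⟨
      suc m ×′ 1# + 0#  ≈⟨ +-congˡ -0#≈0# ⟨
      suc m ×′ 1# - 0#  ∎
    ⊖-homo (suc m) (suc n) = begin-equality
      ⟦ suc m ℤ.⊖ suc n ⟧            ≡⟨ ≡.cong ⟦_⟧ (ℤ.[1+m]⊖[1+n]≡m⊖n m n) ⟩
      ⟦ m ℤ.⊖ n ⟧                    ≈⟨ ⊖-homo m n ⟩
      m ×′ 1# - n ×′ 1#              ≈⟨ cancel _ _ ⟩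
      (1# + m ×′ 1#) - (1# + n ×′ 1#) ≈⟨ +-cong (suc-homo m) (-‿cong (suc-homo n)) ⟨
      suc m ×′ 1# - suc n ×′ 1#      ∎

    +-homo : ∀ i j → ⟦ i ℤ.+ j ⟧ ≈ ⟦ i ⟧ + ⟦ j ⟧
    +-homo (ℤ.+ m)      (ℤ.+ n)      = ×-homo-+ 1# m n
    +-homo (ℤ.+ m)      ℤ.-[1+ n ]   = ⊖-homo m (suc n)
    +-homo ℤ.-[1+ m ]   (ℤ.+ n)      = trans (⊖-homo n (suc m)) (+-comm _ _)
    +-homo ℤ.-[1+ m ]   ℤ.-[1+ n ]   = begin-equality
      - (suc (suc (m ℕ.+ n)) ×′ 1#)               ≈⟨ -‿cong (suc-homo (suc (m ℕ.+ n))) ⟩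
      - (1# + suc (m ℕ.+ n) ×′ 1#)                ≈⟨ -‿cong (+-congˡ (×-homo-+ 1# (suc m) n)) ⟩
      - (1# + (suc m ×′ 1# + n ×′ 1#))            ≈⟨ -‿cong (+-assoc _ _ _) ⟨
      - (1# + suc m ×′ 1# + n ×′ 1#)              ≈⟨ -‿cong (+-congʳ (+-comm _ _)) ⟩
      - (suc m ×′ 1# + 1# + n ×′ 1#)              ≈⟨ -‿cong (+-assoc _ _ _) ⟩
      - (suc m ×′ 1# + (1# + n ×′ 1#))            ≈⟨ -‿cong (+-congˡ (suc-homo n)) ⟨
      - (suc m ×′ 1# + suc n ×′ 1#)               ≈⟨ -‿+-comm _ _ ⟨
      - (suc m ×′ 1#) - (suc n ×′ 1#)             ∎

    -‿homo : ∀ i → ⟦ ℤ.- i ⟧ ≈ - ⟦ i ⟧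
    -‿homo ℤ.-[1+ n ]       = sym (-‿involutive _)
    -‿homo (ℤ.+ zero)       = sym -0#≈0#
    -‿homo (ℤ.+ (suc n))    = refl

    pos-*-homo : ∀ m n → ⟦ Sign.+ ℤ.◃ m ℕ.* n ⟧ ≈ m ×′ 1# * n ×′ 1#
    pos-*-homo m n = trans (reflexive (≡.cong ⟦_⟧ (ℤ.+◃n≡+n (m ℕ.* n)))) (×1-homo-* m n)

    neg-*-homo : ∀ m n → ⟦ Sign.- ℤ.◃ m ℕ.* n ⟧ ≈ - (m ×′ 1# * n ×′ 1#)
    neg-*-homo m n = begin-equality
      ⟦ Sign.- ℤ.◃ m ℕ.* n ⟧    ≡⟨ ≡.cong ⟦_⟧ (ℤ.-◃n≡-n (m ℕ.* n)) ⟩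
      ⟦ ℤ.- (ℤ.+ (m ℕ.* n)) ⟧   ≈⟨ -‿homo (ℤ.+ (m ℕ.* n)) ⟩
      - ((m ℕ.* n) ×′ 1#)       ≈⟨ -‿cong (×1-homo-* m n) ⟩
      - (m ×′ 1# * n ×′ 1#)     ∎

    *-homo : ∀ i j → ⟦ i ℤ.* j ⟧ ≈ ⟦ i ⟧ * ⟦ j ⟧
    *-homo (ℤ.+ m)    (ℤ.+ n)    = pos-*-homo m n
    *-homo (ℤ.+ m)    ℤ.-[1+ n ] = trans (neg-*-homo m (suc n)) (-‿distribʳ-* _ _)
    *-homo ℤ.-[1+ m ] (ℤ.+ n)    = trans (neg-*-homo (suc m) n) (-‿distribˡ-* _ _)
    *-homo ℤ.-[1+ m ] ℤ.-[1+ n ] = begin-equality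
      ⟦ Sign.+ ℤ.◃ suc m ℕ.* suc n ⟧     ≈⟨ pos-*-homo (suc m) (suc n) ⟩
      suc m ×′ 1# * suc n ×′ 1#           ≈⟨ -‿involutive _ ⟨
      - - (suc m ×′ 1# * suc n ×′ 1#)     ≈⟨ -‿cong (-‿distribʳ-* _ _) ⟩
      - (suc m ×′ 1# * - (suc n ×′ 1#))   ≈⟨ -‿distribˡ-* _ _ ⟩
      - (suc m ×′ 1#) * - (suc n ×′ 1#)   ∎

    almostCommutativeRing : AlmostCommutativeRing 0ℓ 0ℓ
    almostCommutativeRing = fromCommutativeRing commutativeRing

    homomorphism : ℤ.+-*-rawRing -Raw-AlmostCommutative⟶ almostCommutativeRing
    homomorphism = record
      { ⟦_⟧    = ⟦_⟧
      ; +-homo = +-homo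
      ; *-homo = *-homo
      ; -‿homo = -‿homo
      ; 0-homo = refl
      ; 1-homo = refl
      }

    _≟_ : ∀ i j → Maybe (⟦ i ⟧ ≈ ⟦ j ⟧)
    i ≟ j with i ℤ.≟ j
    ... | yes i≡j = just (reflexive (≡.cong ⟦_⟧ i≡j))
    ... | no  _   = nothing

  open RingSolver ℤ.+-*-rawRing IntegerCoefficients.almostCommutativeRing
    IntegerCoefficients.homomorphism IntegerCoefficients._≟_ public
    using (solve; _:=_; _:+_; _:*_; _:-_; :-_; con; Polynomial)

  :0 :1 : ∀ {n} → Polynomial n
  :0 = con (ℤ.+ 0)
  :1 = con (ℤ.+ 1)

  ≤-refl : ∀ {x} → x ≤ x
  ≤-refl = inj₂ refl

  ≤-trans : ∀ {x y z} → x ≤ y → y ≤ z → x ≤ z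
  ≤-trans {x} {y} {z} x≤y y≤z = begin
    x ≤⟨ x≤y ⟩
    y ≤⟨ y≤z ⟩
    z ∎

  ≤-<-trans : ∀ {x y z} → x ≤ y → y < z → x < z
  ≤-<-trans {x} {y} {z} x≤y y<z = begin-strict
    x ≤⟨ x≤y ⟩
    y <⟨ y<z ⟩
    z ∎

  <-≤-trans : ∀ {x y z} → x < y → y ≤ z → x < z
  <-≤-trans {x} {y} {z} x<y y≤z = begin-strict
    x <⟨ x<y ⟩
    y ≤⟨ y≤z ⟩
    z ∎

  <⇒≱ : ∀ {x y} → x < y → ¬ y ≤ x
  <⇒≱ x<y y≤x = <-irrefl refl (<-≤-trans x<y y≤x)

  antisym : ∀ {x y} → x ≤ y → y ≤ x → x ≈ y
  antisym (inj₂ x≈y) _   = x≈y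
  antisym (inj₁ x<y) y≤x = ⊥-elim (<⇒≱ x<y y≤x)

  _<?≤_ : ∀ x y → x < y ⊎ y ≤ x
  x <?≤ y with compare x y
  ... | tri< x<y _ _ = inj₁ x<y
  ... | tri≈ _ x≈y _ = inj₂ (inj₂ (sym x≈y))
  ... | tri> _ _ y<x = inj₂ (inj₁ y<x)

  ≮⇒≥ : ∀ {x y} → ¬ x < y → y ≤ x
  ≮⇒≥ {x} {y} x≮y with x <?≤ y
  ... | inj₁ x<y = ⊥-elim (x≮y x<y)
  ... | inj₂ y≤x = y≤x

  -- Linear inequalities are proved by exhibiting the difference of their
  -- sides as a combination of quantities with known sign.

  ≤-by : ∀ {x y d} → 0# ≤ d → y - x ≈ d → x ≤ y
  ≤-by {x} {y} {d} (inj₁ 0<d) y-x≈d = inj₁ (begin-strict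
    x           ≈⟨ +-identityˡ x ⟨
    0# + x      <⟨ +-monoˡ-< x 0<d ⟩
    d + x       ≈⟨ +-congʳ y-x≈d ⟨
    (y - x) + x ≈⟨ solve 2 (λ x y → (y :- x) :+ x := y) refl x y ⟩
    y           ∎)
  ≤-by {x} {y} {d} (inj₂ 0≈d) y-x≈d = inj₂ (begin-equality
    x           ≈⟨ +-identityˡ x ⟨
    0# + x      ≈⟨ +-congʳ 0≈d ⟩
    d + x       ≈⟨ +-congʳ y-x≈d ⟨
    (y - x) + x ≈⟨ solve 2 (λ x y → (y :- x) :+ x := y) refl x y ⟩
    y           ∎)

  <-by : ∀ {x y d} → 0# < d → y - x ≈ d → x < y
  <-by {x} {y} {d} 0<d y-x≈d = begin-strict
    x           ≈⟨ +-identityˡ x ⟨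
    0# + x      <⟨ +-monoˡ-< x 0<d ⟩
    d + x       ≈⟨ +-congʳ y-x≈d ⟨
    (y - x) + x ≈⟨ solve 2 (λ x y → (y :- x) :+ x := y) refl x y ⟩
    y           ∎

  x<y⇒0<y-x : ∀ {x y} → x < y → 0# < y - x
  x<y⇒0<y-x {x} {y} x<y = begin-strict
    0#     ≈⟨ -‿inverseʳ x ⟨
    x - x  <⟨ +-monoˡ-< (- x) x<y ⟩
    y - x  ∎

  x≤y⇒0≤y-x : ∀ {x y} → x ≤ y → 0# ≤ y - x
  x≤y⇒0≤y-x (inj₁ x<y) = inj₁ (x<y⇒0<y-x x<y)
  x≤y⇒0≤y-x {x} {y} (inj₂ x≈y) = inj₂ (begin-equality
    0#     ≈⟨ -‿inverseʳ x ⟨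
    x - x  ≈⟨ +-congʳ x≈y ⟩
    y - x  ∎)

  infixl 6 _+≤_ _+<_
  infixl 7 _*≤_

  _+<_ : ∀ {x y} → 0# ≤ x → 0# < y → 0# < x + y
  _+<_ {x} {y} 0≤x 0<y = ≤-<-trans 0≤x (<-by 0<y (solve 2 (λ x y → (x :+ y) :- x := y) refl x y))

  _+≤_ : ∀ {x y} → 0# ≤ x → 0# ≤ y → 0# ≤ x + y
  _+≤_ {x} {y} 0≤x 0≤y = ≤-trans 0≤x (≤-by 0≤y (solve 2 (λ x y → (x :+ y) :- x := y) refl x y))

  _*≤_ : ∀ {x y} → 0# ≤ x → 0# ≤ y → 0# ≤ x * y
  inj₁ 0<x *≤ inj₁ 0<y = inj₁ (*-pos 0<x 0<y)
  _*≤_ {x} {y} (inj₂ 0≈x) _ = inj₂ (trans (sym (zeroˡ y)) (*-congʳ 0≈x))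
  _*≤_ {x} {y} _ (inj₂ 0≈y) = inj₂ (trans (sym (zeroʳ x)) (*-congˡ 0≈y))

  square-nonneg : ∀ x → 0# ≤ x * x
  square-nonneg x with compare 0# x
  ... | tri< 0<x _ _ = inj₁ (*-pos 0<x 0<x)
  ... | tri≈ _ 0≈x _ = inj₂ 0≈x *≤ inj₂ 0≈x
  ... | tri> _ _ x<0 = ≤-trans (0≤-x *≤ 0≤-x)
    (inj₂ (solve 1 (λ x → (:0 :- x) :* (:0 :- x) := x :* x) refl x))
    where
    0≤-x : 0# ≤ 0# - x
    0≤-x = inj₁ (x<y⇒0<y-x x<0)

  *-cancel-nonneg : ∀ {x y} → 0# < x → 0# ≤ x * y → 0# ≤ y
  *-cancel-nonneg {x} {y} 0<x 0≤xy = ≮⇒≥ λ y<0 → <⇒≱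
    (<-by (*-pos 0<x (x<y⇒0<y-x y<0))
      (solve 2 (λ x y → :0 :- x :* y := x :* (:0 :- y)) refl x y)) 0≤xy

  /-cancel : ∀ {x y} → 0# < y → y * (x / y) ≈ x
  /-cancel {x} {y} 0<y = begin-equality
    y * (x * y ⁻¹)  ≈⟨ solve 3 (λ x y z → y :* (x :* z) := x :* (y :* z)) refl x y (y ⁻¹) ⟩
    x * (y * y ⁻¹)  ≈⟨ *-congˡ (⁻¹-inverseʳ (λ y≈0 → <-irrefl (sym y≈0) 0<y)) ⟩
    x * 1#          ≈⟨ *-identityʳ x ⟩
    x               ∎

  /-pos : ∀ {x y} → 0# < x → 0# < y → 0# < x / y
  /-pos {x} {y} 0<x 0<y with 0# <?≤ (x / y)
  ... | inj₁ 0<q = 0<q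
  ... | inj₂ q≤0 = ⊥-elim (<⇒≱ 0<x (≤-by (inj₁ 0<y *≤ x≤y⇒0≤y-x q≤0) (begin-equality
    0# - x            ≈⟨ +-congˡ (-‿cong (/-cancel 0<y)) ⟨
    0# - y * (x / y)  ≈⟨ solve 2 (λ y q → :0 :- y :* q := y :* (:0 :- q)) refl y (x / y) ⟩
    y * (0# - x / y)  ∎)))

  0<2 : 0# < 2#
  0<2 = inj₁ 0<1 +< 0<1

  dense : ∀ {x y} → x < y → ∃[ z ] (x < z × z < y)
  dense {x} {y} x<y = x + h , <-by 0<h (solve 2 (λ x h → (x :+ h) :- x := h) refl x h) , <-by 0<h (begin-equality
    y - (x + h)                ≈⟨ solve 3 (λ x y h → y :- (x :+ h) := (y :- x) :- h) refl x y h ⟩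
    (y - x) - h                ≈⟨ +-congʳ (/-cancel {y - x} 0<2) ⟨
    2# * h - h                 ≈⟨ solve 1 (λ h → (:1 :+ :1) :* h :- h := h) refl h ⟩
    h                          ∎)
    where
    h : Carrier
    h = (y - x) / 2#
    0<h : 0# < h
    0<h = /-pos (x<y⇒0<y-x x<y) 0<2

  -- Each `x` in `P` satisfies `x + δ ≤ sup`, so `sup - δ` would be a smaller upper bound. This form
  -- of the Archimedean property replaces limits in the recurrence argument.
  translation-closed⇒unbounded : ∀ (P : Pred Carrier 0ℓ) {δ} → ∃ P → 0# < δ →
    (∀ x → P x → P (x + δ)) → ¬ ∃ (IsUpperBound _≤_ P)
  translation-closed⇒unbounded P {δ} inhabited 0<δ closed bounded = <⇒≱ sup-δ<sup (least (sup - δ) λ x Px →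
    ≤-by (x≤y⇒0≤y-x (upper (x + δ) (closed x Px))) (solve 3 (λ s d x → (s :- d) :- x := s :- (x :+ d)) refl sup δ x))
    where
    supremum : ∃ (IsSupremum _≤_ P)
    supremum = complete P inhabited bounded
    sup : Carrier
    sup = proj₁ supremum
    upper : IsUpperBound _≤_ P sup
    upper = proj₁ (proj₂ supremum)
    least : ∀ b → IsUpperBound _≤_ P b → sup ≤ b
    least = proj₂ (proj₂ supremum)
    sup-δ<sup : sup - δ < sup
    sup-δ<sup = <-by 0<δ (solve 2 (λ s d → s :- (s :- d) := d) refl sup δ)

-- Integration of step functions.

module StepFunction (ℝ : CompleteOrderedField) where
  open CompleteOrderedField ℝ
  open OrderedField ℝ
  open OrderReasoning

  -- A list of steps is a formal sum of weighted indicators of open intervals. The intervals may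
  -- overlap and the weights may be negative, so no common partition has to be maintained.
  record Step : Set where
    constructor step
    field
      weight lo hi : Carrier

  open Step

  at : Step → Carrier → Carrier
  at f q with lo f <?≤ q | q <?≤ hi f
  ... | inj₁ _ | inj₁ _ = weight f
  ... | inj₁ _ | inj₂ _ = 0#
  ... | inj₂ _ | _      = 0#

  at-inside : ∀ f {q} → lo f < q → q < hi f → at f q ≈ weight f
  at-inside f {q} lo<q q<hi with lo f <?≤ q | q <?≤ hi f
  ... | inj₁ _    | inj₁ _    = refl
  ... | inj₁ _    | inj₂ hi≤q = ⊥-elim (<⇒≱ q<hi hi≤q)
  ... | inj₂ q≤lo | _         = ⊥-elim (<⇒≱ lo<q q≤lo)

  at-outside : ∀ f {q} → ¬ (lo f < q × q < hi f) → at f q ≈ 0#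
  at-outside f {q} outside with lo f <?≤ q | q <?≤ hi f
  ... | inj₁ lo<q | inj₁ q<hi = ⊥-elim (outside (lo<q , q<hi))
  ... | inj₁ _    | inj₂ _    = refl
  ... | inj₂ _    | _         = refl

  value : List Step → Carrier → Carrier
  value []       q = 0#
  value (f ∷ fs) q = at f q + value fs q

  integral : List Step → Carrier
  integral []       = 0#
  integral (f ∷ fs) = weight f * (hi f - lo f) + integral fs

  value-++ : ∀ fs gs q → value (fs ++ gs) q ≈ value fs q + value gs q
  value-++ []       gs q = sym (+-identityˡ _)
  value-++ (f ∷ fs) gs q = trans (+-congˡ (value-++ fs gs q)) (sym (+-assoc _ _ _))

  integral-++ : ∀ fs gs → integral (fs ++ gs) ≈ integral fs + integral gs
  integral-++ []       gs = sym (+-identityˡ _)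
  integral-++ (f ∷ fs) gs = trans (+-congˡ (integral-++ fs gs)) (sym (+-assoc _ _ _))

  Ordered : Step → Set
  Ordered f = lo f ≤ hi f

  Avoids : Carrier → Step → Set
  Avoids q f = ¬ q ≈ lo f × ¬ q ≈ hi f

  -- A primitive of the indicator of the interval: slope 1 inside, constant on either side.
  clamp : Step → Carrier → Carrier
  clamp f x with x <?≤ lo f | x <?≤ hi f
  ... | inj₁ _ | _      = lo f
  ... | inj₂ _ | inj₁ _ = x
  ... | inj₂ _ | inj₂ _ = hi f

  clamp-below : ∀ f {x} → Ordered f → x ≤ lo f → clamp f x ≈ lo f
  clamp-below f {x} lo≤hi x≤lo with x <?≤ lo f | x <?≤ hi f
  ... | inj₁ _    | _         = refl
  ... | inj₂ lo≤x | inj₁ _    = antisym x≤lo lo≤x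
  ... | inj₂ lo≤x | inj₂ hi≤x = antisym (≤-trans hi≤x x≤lo) lo≤hi

  clamp-above : ∀ f {x} → Ordered f → hi f ≤ x → clamp f x ≈ hi f
  clamp-above f {x} lo≤hi hi≤x with x <?≤ lo f | x <?≤ hi f
  ... | inj₁ x<lo | _         = ⊥-elim (<⇒≱ (<-≤-trans x<lo lo≤hi) hi≤x)
  ... | inj₂ _    | inj₁ x<hi = ⊥-elim (<⇒≱ x<hi hi≤x)
  ... | inj₂ _    | inj₂ _    = refl

  clamp-inside : ∀ f {x} → lo f ≤ x → x ≤ hi f → clamp f x ≈ x
  clamp-inside f {x} lo≤x x≤hi with x <?≤ lo f | x <?≤ hi f
  ... | inj₁ x<lo | _         = ⊥-elim (<⇒≱ x<lo lo≤x)
  ... | inj₂ _    | inj₁ _    = refl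
  ... | inj₂ _    | inj₂ hi≤x = antisym hi≤x x≤hi

  
  antiderivative : List Step → Carrier → Carrier
  antiderivative []       x = 0#
  antiderivative (f ∷ fs) x = weight f * clamp f x + antiderivative fs x

  Outside : Carrier → Carrier → Carrier → Set
  Outside c d b = b ≤ c ⊎ d ≤ b

  -- With no endpoint of `f` strictly between `c` and `d`, the interval (c, d) lies to the right of
  -- the step, within it, or to its left; `clamp f` is affine in each case.
  step-linear : ∀ f {c d q} → Ordered f → c < q → q < d →
    Outside c d (lo f) → Outside c d (hi f) →
    weight f * clamp f d - weight f * clamp f c ≈ (d - c) * at f q
  step-linear f {c} {d} {q} lo≤hi c<q q<d = λ where
      (inj₁ lo≤c) (inj₁ hi≤c) → vanishing
        (trans (clamp-above f lo≤hi (≤-trans hi≤c c≤d)) (sym (clamp-above f lo≤hi hi≤c)))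
        λ (_ , q<hi) → <⇒≱ (<-trans c<q q<hi) hi≤c
      (inj₁ lo≤c) (inj₂ d≤hi) → begin-equality
        weight f * clamp f d - weight f * clamp f c
          ≈⟨ +-cong (*-congˡ (clamp-inside f (≤-trans lo≤c c≤d) d≤hi)) (-‿cong (*-congˡ (clamp-inside f lo≤c (≤-trans c≤d d≤hi)))) ⟩
        weight f * d - weight f * c
          ≈⟨ solve 3 (λ w c d → w :* d :- w :* c := (d :- c) :* w) refl (weight f) c d ⟩
        (d - c) * weight f
          ≈⟨ *-congˡ (at-inside f (≤-<-trans lo≤c c<q) (<-≤-trans q<d d≤hi)) ⟨
        (d - c) * at f q ∎
      (inj₂ d≤lo) _ → vanishing
        (trans (clamp-below f lo≤hi d≤lo) (sym (clamp-below f lo≤hi (≤-trans c≤d d≤lo))))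
        λ (lo<q , _) → <⇒≱ (<-trans lo<q q<d) d≤lo
    where
    c≤d : c ≤ d
    c≤d = inj₁ (<-trans c<q q<d)
    vanishing : clamp f d ≈ clamp f c → ¬ (lo f < q × q < hi f) →
      weight f * clamp f d - weight f * clamp f c ≈ (d - c) * at f q
    vanishing eq outside = begin-equality
      weight f * clamp f d - weight f * clamp f c  ≈⟨ +-congʳ (*-congˡ eq) ⟩
      weight f * clamp f c - weight f * clamp f c  ≈⟨ -‿inverseʳ _ ⟩
      0#                                           ≈⟨ zeroʳ (d - c) ⟨
      (d - c) * 0#                                 ≈⟨ *-congˡ (at-outside f outside) ⟨
      (d - c) * at f q                             ∎

  antiderivative-linear : ∀ {fs c d q} → All Ordered fs → c < q → q < d →
    All (λ f → Outside c d (lo f) × Outside c d (hi f)) fs →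
    antiderivative fs d - antiderivative fs c ≈ (d - c) * value fs q
  antiderivative-linear {c = c} {d} [] c<q q<d [] = solve 2 (λ c d → :0 :- :0 := (d :- c) :* :0) refl c d
  antiderivative-linear {f ∷ fs} {c} {d} {q} (lo≤hi ∷ ordered) c<q q<d ((o₁ , o₂) ∷ os) = begin-equality
    (weight f * clamp f d + antiderivative fs d) - (weight f * clamp f c + antiderivative fs c)
      ≈⟨ solve 4 (λ x y z w → (x :+ y) :- (z :+ w) := (x :- z) :+ (y :- w)) refl
           (weight f * clamp f d) (antiderivative fs d) (weight f * clamp f c) (antiderivative fs c) ⟩
    (weight f * clamp f d - weight f * clamp f c) + (antiderivative fs d - antiderivative fs c)
      ≈⟨ +-cong (step-linear f lo≤hi c<q q<d o₁ o₂) (antiderivative-linear ordered c<q q<d os) ⟩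
    (d - c) * at f q + (d - c) * value fs q
      ≈⟨ distribˡ (d - c) _ _ ⟨
    (d - c) * (at f q + value fs q) ∎

  module _ {fs : List Step} (ordered : All Ordered fs)
           (nonneg : ∀ q → All (Avoids q) fs → 0# ≤ value fs q) where

    -- Induction invariant: an endpoint that may still lie inside (c, d) is among the pending cut
    -- points `bs`.
    Separated : List Carrier → Carrier → Carrier → Carrier → Set
    Separated bs c d b = b ∈ bs ⊎ Outside c d b

    -- The interval is cut at the pending points one at a time. When none remains, the
    -- antiderivative is affine there, and its slope is the value at an interior point, which avoids
    -- every endpoint.
    antiderivative-mono : ∀ bs {c d} → c < d →
      All (λ f → Separated bs c d (lo f) × Separated bs c d (hi f)) fs →
      antiderivative fs c ≤ antiderivative fs d
    antiderivative-mono [] {c} {d} c<d separated =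
      ≤-by (inj₁ (x<y⇒0<y-x c<d) *≤ nonneg q (All.map (λ (o₁ , o₂) → q≉ o₁ , q≉ o₂) outside))
           (antiderivative-linear ordered c<q q<d outside)
      where
      q : Carrier
      q = proj₁ (dense c<d)
      c<q : c < q
      c<q = proj₁ (proj₂ (dense c<d))
      q<d : q < d
      q<d = proj₂ (proj₂ (dense c<d))
      drop : ∀ {b} → Separated [] c d b → Outside c d b
      drop (inj₂ o) = o
      outside : All (λ f → Outside c d (lo f) × Outside c d (hi f)) fs
      outside = All.map (λ (s₁ , s₂) → drop s₁ , drop s₂) separated
      q≉ : ∀ {b} → Outside c d b → ¬ q ≈ b
      q≉ (inj₁ b≤c) q≈b = <⇒≱ c<q (≤-trans (inj₂ q≈b) b≤c)
      q≉ (inj₂ d≤b) q≈b = <⇒≱ q<d (≤-trans d≤b (inj₂ (sym q≈b)))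
    antiderivative-mono (p ∷ bs) {c} {d} c<d separated with c <?≤ p | p <?≤ d
    ... | inj₁ c<p | inj₁ p<d = ≤-trans
      (antiderivative-mono bs c<p (All.map (λ (s₁ , s₂) → lower s₁ , lower s₂) separated))
      (antiderivative-mono bs p<d (All.map (λ (s₁ , s₂) → upper s₁ , upper s₂) separated))
      where
      lower : ∀ {b} → Separated (p ∷ bs) c d b → Separated bs c p b
      lower (inj₁ (here ≡.refl)) = inj₂ (inj₂ ≤-refl)
      lower (inj₁ (there b∈bs))  = inj₁ b∈bs
      lower (inj₂ (inj₁ b≤c))    = inj₂ (inj₁ b≤c)
      lower (inj₂ (inj₂ d≤b))    = inj₂ (inj₂ (≤-trans (inj₁ p<d) d≤b))
      upper : ∀ {b} → Separated (p ∷ bs) c d b → Separated bs p d b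
      upper (inj₁ (here ≡.refl)) = inj₂ (inj₁ ≤-refl)
      upper (inj₁ (there b∈bs))  = inj₁ b∈bs
      upper (inj₂ (inj₁ b≤c))    = inj₂ (inj₁ (≤-trans b≤c (inj₁ c<p)))
      upper (inj₂ (inj₂ d≤b))    = inj₂ (inj₂ d≤b)
    ... | inj₂ p≤c | _ = antiderivative-mono bs c<d (All.map (λ (s₁ , s₂) → skip s₁ , skip s₂) separated)
      where
      skip : ∀ {b} → Separated (p ∷ bs) c d b → Separated bs c d b
      skip (inj₁ (here ≡.refl)) = inj₂ (inj₁ p≤c)
      skip (inj₁ (there b∈bs))  = inj₁ b∈bs
      skip (inj₂ o)             = inj₂ o
    ... | inj₁ _ | inj₂ d≤p = antiderivative-mono bs c<d (All.map (λ (s₁ , s₂) → skip s₁ , skip s₂) separated)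
      where
      skip : ∀ {b} → Separated (p ∷ bs) c d b → Separated bs c d b
      skip (inj₁ (here ≡.refl)) = inj₂ (inj₂ d≤p)
      skip (inj₁ (there b∈bs))  = inj₁ b∈bs
      skip (inj₂ o)             = inj₂ o

  endpoints : List Step → List Carrier
  endpoints []       = []
  endpoints (f ∷ fs) = lo f ∷ hi f ∷ endpoints fs

  endpoints-complete : ∀ fs → All (λ f → lo f ∈ endpoints fs × hi f ∈ endpoints fs) fs
  endpoints-complete []       = []
  endpoints-complete (f ∷ fs) = (here ≡.refl , there (here ≡.refl)) ∷
    All.map (λ (l , h) → there (there l) , there (there h)) (endpoints-complete fs)

  Within : Carrier → Carrier → Step → Set
  Within c d f = c ≤ lo f × hi f ≤ d

  bounded : ∀ fs → ∃[ c ] ∃[ d ] (c < d × All (Within c d) fs)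
  bounded [] = 0# , 1# , 0<1 , []
  bounded (f ∷ fs) with bounded fs
  ... | c , d , c<d , within with c <?≤ lo f | d <?≤ hi f
  ... | inj₁ c<lo | inj₁ d<hi = c , hi f , <-trans c<d d<hi , (inj₁ c<lo , ≤-refl) ∷
    All.map (λ (l , h) → l , ≤-trans h (inj₁ d<hi)) within
  ... | inj₁ c<lo | inj₂ hi≤d = c , d , c<d , (inj₁ c<lo , hi≤d) ∷ within
  ... | inj₂ lo≤c | inj₁ d<hi = lo f , hi f , ≤-<-trans lo≤c (<-trans c<d d<hi) , (≤-refl , ≤-refl) ∷
    All.map (λ (l , h) → ≤-trans lo≤c l , ≤-trans h (inj₁ d<hi)) within
  ... | inj₂ lo≤c | inj₂ hi≤d = lo f , d , ≤-<-trans lo≤c c<d , (≤-refl , hi≤d) ∷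
    All.map (λ (l , h) → ≤-trans lo≤c l , h) within

  antiderivative-integral : ∀ {fs c d} → All Ordered fs → All (Within c d) fs →
    antiderivative fs d - antiderivative fs c ≈ integral fs
  antiderivative-integral [] [] = -‿inverseʳ 0#
  antiderivative-integral {f ∷ fs} {c} {d} (lo≤hi ∷ ordered) ((c≤lo , hi≤d) ∷ within) = begin-equality
    (weight f * clamp f d + antiderivative fs d) - (weight f * clamp f c + antiderivative fs c)
      ≈⟨ solve 5 (λ w x y z u → (w :* x :+ y) :- (w :* z :+ u) := w :* (x :- z) :+ (y :- u)) refl
           (weight f) (clamp f d) (antiderivative fs d) (clamp f c) (antiderivative fs c) ⟩
    weight f * (clamp f d - clamp f c) + (antiderivative fs d - antiderivative fs c)
      ≈⟨ +-cong (*-congˡ (+-cong (clamp-above f lo≤hi hi≤d) (-‿cong (clamp-below f lo≤hi c≤lo)))) (antiderivative-integral ordered within) ⟩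
    weight f * (hi f - lo f) + integral fs ∎

  -- The integral is the increment of the monotone antiderivative over an interval containing all
  -- the steps. Endpoints are exempt from the hypothesis, being finite in number.
  integral-nonneg : ∀ {fs} → All Ordered fs →
    (∀ q → All (Avoids q) fs → 0# ≤ value fs q) → 0# ≤ integral fs
  integral-nonneg {fs} ordered nonneg with bounded fs
  ... | c , d , c<d , within = ≤-trans
    (x≤y⇒0≤y-x (antiderivative-mono ordered nonneg (endpoints fs) c<d
      (All.map (λ (l , h) → inj₁ l , inj₁ h) (endpoints-complete fs))))
    (inj₂ (antiderivative-integral ordered within))

-- The recurrence has no unboundedly growing solution below the critical ratio.

module GrowthRecurrence (ℝ : CompleteOrderedField) where
  open CompleteOrderedField ℝ
  open OrderedField ℝ
  open OrderReasoning

  module _ {c σ r : Carrier} (1≤c : 1# ≤ c) (0≤σ : 0# ≤ σ) (σ²≈2c : σ * σ ≈ 2# * c)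
           (r<R : r < 1# + 2# * (c + σ))
           (S : ℕ → Carrier)
           (increasing : ∀ n → S n + 1# ≤ S (suc n))
           (recurrence : ∀ n → 2# * S (suc n) + c * (S (suc (suc n)) - S n)
                                 ≤ (r + 1#) * (S (suc n) - S n)) where

    private
      R ε δ : Carrier
      R = 1# + 2# * (c + σ)
      ε = R - r
      -- Chosen so that `c * δ * b ≤ ε * (b - a)` amounts to `2# * b ≤ R * (b - a)`.
      δ = (2# * ε) / (c * R)

      0<c : 0# < c
      0<c = <-≤-trans 0<1 1≤c

      0<R : 0# < R
      0<R = ≤-<-trans (inj₁ 0<2 *≤ (inj₁ 0<c +≤ 0≤σ))
        (<-by 0<1 (solve 1 (λ x → (:1 :+ x) :- x := :1) refl _))

      0<ε : 0# < ε
      0<ε = x<y⇒0<y-x r<R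

      0<δ : 0# < δ
      0<δ = /-pos (*-pos 0<2 0<ε) (*-pos 0<c 0<R)

      cRδ≈2ε : c * R * δ ≈ 2# * ε
      cRδ≈2ε = /-cancel (*-pos 0<c 0<R)

    -- With μ = c + σ the hypothesis reads, up to the slack ε,
    -- c² d ≤ 2cμ b - μ² a for consecutive terms a, b, d.  As
    -- (c b - μ a)² ≥ 0, the quotients of consecutive terms decrease, and the
    -- slack makes them do so by at least δ.
    quotient-decrease : ∀ n {K} → 0# < S n → S (suc n) ≤ K * S n →
      S (suc (suc n)) ≤ (K - δ) * S (suc n)
    quotient-decrease n {K} 0<a b≤Ka = ≤-by
      (*-cancel-nonneg (*-pos (*-pos 0<c 0<c) 0<a) (≤-trans total (inj₂ (sym identity)))) refl
      where
      a b d H X : Carrier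
      a = S n
      b = S (suc n)
      d = S (suc (suc n))
      H = (r + 1#) * (b - a) - (2# * b + c * (d - a))
      X = ε * (b - a) - c * δ * b

      0≤H : 0# ≤ H
      0≤H = x≤y⇒0≤y-x (recurrence n)

      step≥0 : ∀ m → 0# ≤ S (suc m) - S m
      step≥0 m = ≤-trans (inj₁ 0<1) (≤-by (x≤y⇒0≤y-x (increasing m))
        (solve 2 (λ x y → (y :- x) :- :1 := y :- (x :+ :1)) refl (S m) (S (suc m))))

      0<b : 0# < b
      0<b = <-≤-trans 0<a (≤-by (step≥0 n) refl)

      -- `R * X` equals ε (R (b - a) - 2 b). The recurrence and b ≤ d give 2 b ≤ (r + 1 - c) (b -
      -- a), and r + 1 - c ≤ R since c ≥ 1.
      0≤RX : 0# ≤ R * X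
      0≤RX = ≤-trans
        (inj₁ 0<ε *≤ (0≤H +≤ x≤y⇒0≤y-x 1≤c *≤ step≥0 n +≤ inj₁ 0<c *≤ step≥0 (suc n) +≤ inj₁ 0<ε *≤ step≥0 n))
        (inj₂ (sym (begin-equality
          R * (ε * (b - a) - c * δ * b)
            ≈⟨ solve 6 (λ R e a b c t → R :* (e :* (b :- a) :- c :* t :* b) :=
                 R :* (e :* (b :- a)) :- c :* R :* t :* b) refl R ε a b c δ ⟩
          R * (ε * (b - a)) - c * R * δ * b
            ≈⟨ +-congˡ (-‿cong (*-congʳ cRδ≈2ε)) ⟩
          R * (ε * (b - a)) - 2# * ε * b
            ≈⟨ solve 6 (λ R r a b c d →
                 R :* ((R :- r) :* (b :- a)) :- (:1 :+ :1) :* (R :- r) :* b :=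
                 (R :- r) :* (((r :+ :1) :* (b :- a) :- ((:1 :+ :1) :* b :+ c :* (d :- a)))
                   :+ (c :- :1) :* (b :- a) :+ c :* (d :- b) :+ (R :- r) :* (b :- a)))
                 refl R r a b c d ⟩
          ε * (H + (c - 1#) * (b - a) + c * (d - b) + ε * (b - a)) ∎)))

      0≤X : 0# ≤ X
      0≤X = *-cancel-nonneg 0<R 0≤RX

      μ : Carrier
      μ = c + σ

      total : 0# ≤ c * a * H + c * a * X + c * c * b * (K * a - b) + (c * b - μ * a) * (c * b - μ * a)
      total = inj₁ (*-pos 0<c 0<a) *≤ 0≤H
           +≤ inj₁ (*-pos 0<c 0<a) *≤ 0≤X
           +≤ inj₁ (*-pos (*-pos 0<c 0<c) 0<b) *≤ x≤y⇒0≤y-x b≤Ka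
           +≤ square-nonneg (c * b - μ * a)

      -- Valid only modulo σ² = 2c: the solver treats σ as a variable and leaves a multiple of
      -- `2# * c - σ * σ`, which is then removed.
      identity : c * c * a * ((K - δ) * b - d) ≈
        c * a * H + c * a * X + c * c * b * (K * a - b) + (c * b - μ * a) * (c * b - μ * a)
      identity = begin-equality
        c * c * a * ((K - δ) * b - d)
          ≈⟨ solve 8 (λ a b d c s r K t → c :* c :* a :* ((K :- t) :* b :- d) :=
               (c :* a :* ((r :+ :1) :* (b :- a) :- ((:1 :+ :1) :* b :+ c :* (d :- a)))
                :+ c :* a :* ((:1 :+ (:1 :+ :1) :* (c :+ s) :- r) :* (b :- a) :- c :* t :* b)
                :+ c :* c :* b :* (K :* a :- b)
                :+ (c :* b :- (c :+ s) :* a) :* (c :* b :- (c :+ s) :* a))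
               :+ a :* a :* ((:1 :+ :1) :* c :- s :* s)) refl a b d c σ r K δ ⟩
        c * a * H + c * a * X + c * c * b * (K * a - b) + (c * b - μ * a) * (c * b - μ * a)
          + a * a * (2# * c - σ * σ)
          ≈⟨ +-congˡ (*-congˡ (+-congˡ (-‿cong σ²≈2c))) ⟩
        c * a * H + c * a * X + c * c * b * (K * a - b) + (c * b - μ * a) * (c * b - μ * a)
          + a * a * (2# * c - 2# * c)
          ≈⟨ solve 3 (λ x y z → x :+ y :* (z :- z) := x) refl _ (a * a) (2# * c) ⟩
        c * a * H + c * a * X + c * c * b * (K * a - b) + (c * b - μ * a) * (c * b - μ * a) ∎

    -- From a positive term on, the quotients stay positive while dropping by `δ` each time. `P`
    -- records their bounds negated, so that the drop becomes an upward translation.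
    positive⇒⊥ : ∀ n → ¬ 0# < S n
    positive⇒⊥ n 0<Sn = translation-closed⇒unbounded P
      (- (S (suc n) / S n) , n , 0<Sn , inj₂ (sym (begin-equality
        - - (S (suc n) / S n) * S n  ≈⟨ solve 2 (λ x y → :- (:- x) :* y := y :* x) refl (S (suc n) / S n) (S n) ⟩
        S n * (S (suc n) / S n)      ≈⟨ /-cancel 0<Sn ⟩
        S (suc n)                    ∎)))
      0<δ closed (0# , bound)
      where
      P : Pred Carrier 0ℓ
      P k = ∃[ m ] (0# < S m × S (suc m) ≤ - k * S m)

      next-positive : ∀ {m} → 0# < S m → 0# < S (suc m)
      next-positive {m} 0<Sm = <-≤-trans (inj₁ 0<Sm +< 0<1) (increasing m)

      closed : ∀ k → P k → P (k + δ)
      closed k (m , 0<Sm , ≤kS) = suc m , next-positive 0<Sm , ≤-trans (quotient-decrease m 0<Sm ≤kS)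
        (inj₂ (*-congʳ (solve 2 (λ k d → :- k :- d := :- (k :+ d)) refl k δ)))

      bound : IsUpperBound _≤_ P 0#
      bound k (m , 0<Sm , ≤kS) = ≮⇒≥ λ 0<k → <⇒≱ (next-positive 0<Sm)
        (≤-trans ≤kS (≤-by (inj₁ (*-pos 0<k 0<Sm)) (solve 2 (λ k x → :0 :- :- k :* x := k :* x) refl k (S m))))

    -- The sequence may start negative, but increments of at least 1 eventually make a term
    -- positive.
    absurd : ⊥
    absurd = translation-closed⇒unbounded P (S 0 , 0 , ≤-refl) 0<1 closed
      (0# , λ x (n , x≤Sn) → ≤-trans x≤Sn (≮⇒≥ (positive⇒⊥ n)))
      where
      P : Pred Carrier 0ℓ
      P x = ∃[ n ] x ≤ S n
      closed : ∀ x → P x → P (x + 1#)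
      closed x (n , x≤Sn) = suc n , ≤-trans
        (≤-by (x≤y⇒0≤y-x x≤Sn) (solve 2 (λ x y → (y :+ :1) :- (x :+ :1) := y :- x) refl x (S n)))
        (increasing n)

-- Positions relative to a point, and reflection of the line.

module Sides (ℝ : CompleteOrderedField) where
  open CompleteOrderedField ℝ
  open OrderedField ℝ

  Separates SameSide : Carrier → Carrier → Carrier → Set
  Separates q x y = (x < q × q < y) ⊎ (y < q × q < x)
  SameSide  q x y = (x < q × y < q) ⊎ (q < x × q < y)

  ≤∧≉⇒< : ∀ {x y} → x ≤ y → ¬ x ≈ y → x < y
  ≤∧≉⇒< (inj₁ x<y) _   = x<y
  ≤∧≉⇒< (inj₂ x≈y) x≉y = ⊥-elim (x≉y x≈y)

  side : ∀ {q x} → ¬ q ≈ x → x < q ⊎ q < x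
  side {q} {x} q≉x with x <?≤ q
  ... | inj₁ x<q = inj₁ x<q
  ... | inj₂ q≤x = inj₂ (≤∧≉⇒< q≤x q≉x)

  separates-split : ∀ {q x y z} → ¬ q ≈ y → Separates q x z → Separates q x y ⊎ Separates q y z
  separates-split q≉y sep with side q≉y | sep
  ... | inj₁ y<q | inj₁ (x<q , q<z) = inj₂ (inj₁ (y<q , q<z))
  ... | inj₁ y<q | inj₂ (z<q , q<x) = inj₁ (inj₂ (y<q , q<x))
  ... | inj₂ q<y | inj₁ (x<q , q<z) = inj₁ (inj₁ (x<q , q<y))
  ... | inj₂ q<y | inj₂ (z<q , q<x) = inj₂ (inj₂ (z<q , q<y))

  sameSide-split : ∀ {q x y z} → ¬ q ≈ y → SameSide q x z → SameSide q x y ⊎ Separates q y z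
  sameSide-split q≉y same with side q≉y | same
  ... | inj₁ y<q | inj₁ (x<q , z<q) = inj₁ (inj₁ (x<q , y<q))
  ... | inj₁ y<q | inj₂ (q<x , q<z) = inj₂ (inj₁ (y<q , q<z))
  ... | inj₂ q<y | inj₁ (x<q , z<q) = inj₂ (inj₂ (z<q , q<y))
  ... | inj₂ q<y | inj₂ (q<x , q<z) = inj₁ (inj₂ (q<x , q<y))

  sameSide-separates : ∀ {q x y z} → SameSide q x z → Separates q y z → Separates q x y
  sameSide-separates (inj₁ (x<q , z<q)) (inj₁ (y<q , q<z)) = ⊥-elim (<-asym z<q q<z)
  sameSide-separates (inj₁ (x<q , z<q)) (inj₂ (_   , q<y)) = inj₁ (x<q , q<y)
  sameSide-separates (inj₂ (q<x , q<z)) (inj₁ (y<q , _))   = inj₂ (y<q , q<x)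
  sameSide-separates (inj₂ (q<x , q<z)) (inj₂ (z<q , q<y)) = ⊥-elim (<-asym z<q q<z)

  -- The coordinate measured positively in direction `d`. Being an involution, it also turns a
  -- distance into the point at that distance on side `d`; arguments about the two half-lines are
  -- thus written once.
  toward : Direction → Carrier → Carrier
  toward left  x = - x
  toward right x = x

  opposite : Direction → Direction
  opposite left  = right
  opposite right = left

  opposite-involutive : ∀ d → opposite (opposite d) ≡ d
  opposite-involutive left  = ≡.refl
  opposite-involutive right = ≡.refl

  toward-cong : ∀ d {x y} → x ≈ y → toward d x ≈ toward d y
  toward-cong left  x≈y = -‿cong x≈y
  toward-cong right x≈y = x≈y

  toward-involutive : ∀ d x → toward d (toward d x) ≈ x
  toward-involutive left  x = solve 1 (λ x → :- (:- x) := x) refl x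
  toward-involutive right x = refl

  toward-opposite : ∀ d x → toward (opposite d) x ≈ - toward d x
  toward-opposite left  x = sym (toward-involutive left x)
  toward-opposite right x = refl

  toward-0 : ∀ d → toward d 0# ≈ 0#
  toward-0 left  = solve 0 (:- :0 := :0) refl
  toward-0 right = refl

  neg-mono-≤ : ∀ {x y} → x ≤ y → - y ≤ - x
  neg-mono-≤ {x} {y} x≤y = ≤-by (x≤y⇒0≤y-x x≤y) (solve 2 (λ x y → :- x :- :- y := y :- x) refl x y)

  neg-mono-< : ∀ {x y} → x < y → - y < - x
  neg-mono-< {x} {y} x<y = <-by (x<y⇒0<y-x x<y) (solve 2 (λ x y → :- x :- :- y := y :- x) refl x y)

  neg-cancel-< : ∀ {x y} → - y < - x → x < y
  neg-cancel-< {x} {y} -y<-x = <-by (x<y⇒0<y-x -y<-x) (solve 2 (λ x y → y :- x := :- x :- :- y) refl x y)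

  toward-separates : ∀ d {q x y} → toward d x < toward d q → toward d q < toward d y → Separates q x y
  toward-separates left  x<q q<y = inj₂ (neg-cancel-< q<y , neg-cancel-< x<q)
  toward-separates right x<q q<y = inj₁ (x<q , q<y)

  toward-sameSide : ∀ d {q x y} → toward d x < toward d q → toward d y < toward d q → SameSide q x y
  toward-sameSide left  x<q y<q = inj₂ (neg-cancel-< x<q , neg-cancel-< y<q)
  toward-sameSide right x<q y<q = inj₁ (x<q , y<q)

-- Time spent on passing each point of the line.

module Trajectories (ℝ : CompleteOrderedField) (v : CompleteOrderedField.Carrier ℝ)
  (0<v : CompleteOrderedField._<_ ℝ (CompleteOrderedField.0# ℝ) v)
  (v<1 : CompleteOrderedField._<_ ℝ v (CompleteOrderedField.1# ℝ))
  (A : LinearSearch.SearchAlgorithm ℝ v) where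

  open CompleteOrderedField ℝ
  open OrderedField ℝ
  open StepFunction ℝ
  open Step
  open Sides ℝ
  open LinearSearch ℝ v
  open SearchAlgorithm A
  open OrderReasoning

  w : Carrier
  w = v ⁻¹

  v*w≈1 : v * w ≈ 1#
  v*w≈1 = ⁻¹-inverseʳ λ v≈0 → <-irrefl (sym v≈0) 0<v

  1≤w : 1# ≤ w
  1≤w = ≤-by (*-cancel-nonneg 0<v (≤-trans (inj₁ (x<y⇒0<y-x v<1)) (inj₂ (begin-equality
    1# - v        ≈⟨ +-congʳ v*w≈1 ⟨
    v * w - v     ≈⟨ solve 2 (λ v w → v :* w :- v := v :* (w :- :1)) refl v w ⟩
    v * (w - 1#)  ∎)))) refl

  -- Time per unit length; used as the weight of a step, it makes the integral of a piece of motion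
  -- its duration.
  cost : Speed → Carrier
  cost fast = 1#
  cost slow = w

  1≤cost : ∀ σ → 1# ≤ cost σ
  1≤cost fast = ≤-refl
  1≤cost slow = 1≤w

  0≤cost : ∀ σ → 0# ≤ cost σ
  0≤cost σ = ≤-trans (inj₁ 0<1) (1≤cost σ)

  cost*speed≈1 : ∀ σ → cost σ * speedValue σ ≈ 1#
  cost*speed≈1 fast = *-identityʳ 1#
  cost*speed≈1 slow = trans (*-comm w v) v*w≈1

  0<speed : ∀ σ → 0# < speedValue σ
  0<speed fast = 0<1
  0<speed slow = 0<v

  0≤speed : ∀ σ → 0# ≤ speedValue σ
  0≤speed σ = inj₁ (0<speed σ)

  speed≤1 : ∀ σ → speedValue σ ≤ 1#
  speed≤1 fast = ≤-refl
  speed≤1 slow = inj₁ v<1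

  ≤-+-nonneg : ∀ {x y z} → x ≤ y → 0# ≤ z → x ≤ z + y
  ≤-+-nonneg {x} {y} {z} x≤y 0≤z = ≤-by (x≤y⇒0≤y-x x≤y +≤ 0≤z)
    (solve 3 (λ x y z → (z :+ y) :- x := (y :- x) :+ z) refl x y z)

  +-mono-≤ : ∀ {x y z u} → x ≤ y → z ≤ u → x + z ≤ y + u
  +-mono-≤ {x} {y} {z} {u} x≤y z≤u = ≤-by (x≤y⇒0≤y-x x≤y +≤ x≤y⇒0≤y-x z≤u)
    (solve 4 (λ x y z u → (y :+ u) :- (x :+ z) := (y :- x) :+ (u :- z)) refl x y z u)

  module _ {σ : Speed} {x y dt : Carrier} where

    Displaced : Direction → Set
    Displaced d = y - x ≈ velocity d σ * dt

    advance : ∀ d → 0# ≤ dt → Displaced d → toward d x ≤ toward d y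
    advance right 0≤dt eq = ≤-by (0≤speed σ *≤ 0≤dt) eq
    advance left  0≤dt eq = ≤-by (0≤speed σ *≤ 0≤dt) (begin-equality
      - y - - x               ≈⟨ solve 2 (λ x y → :- y :- :- x := :- (y :- x)) refl x y ⟩
      - (y - x)               ≈⟨ -‿cong eq ⟩
      - (- speedValue σ * dt) ≈⟨ solve 2 (λ s t → :- (:- s :* t) := s :* t) refl (speedValue σ) dt ⟩
      speedValue σ * dt       ∎)

    advance-at-most : ∀ d e → 0# ≤ dt → Displaced d → toward e y - toward e x ≤ dt
    advance-at-most d e 0≤dt eq = ≤-trans (bound e d eq) (≤-by (x≤y⇒0≤y-x (speed≤1 σ) *≤ 0≤dt)
      (solve 2 (λ s t → t :- s :* t := (:1 :- s) :* t) refl (speedValue σ) dt))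
      where
      s*dt : Carrier
      s*dt = speedValue σ * dt
      -s≤s : - speedValue σ * dt ≤ s*dt
      -s≤s = ≤-by (0≤speed σ *≤ 0≤dt +≤ 0≤speed σ *≤ 0≤dt)
        (solve 2 (λ s t → s :* t :- :- s :* t := s :* t :+ s :* t) refl (speedValue σ) dt)
      negated : ∀ {z} → y - x ≈ z * dt → - y - - x ≈ - z * dt
      negated {z} eq = begin-equality
        - y - - x   ≈⟨ solve 2 (λ x y → :- y :- :- x := :- (y :- x)) refl x y ⟩
        - (y - x)   ≈⟨ -‿cong eq ⟩
        - (z * dt)  ≈⟨ solve 2 (λ z t → :- (z :* t) := :- z :* t) refl z dt ⟩
        - z * dt    ∎
      bound : ∀ e d → Displaced d → toward e y - toward e x ≤ s*dt
      bound right right eq = inj₂ eq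
      bound right left  eq = ≤-trans (inj₂ eq) -s≤s
      bound left  right eq = ≤-trans (inj₂ (negated eq)) -s≤s
      bound left  left  eq = inj₂ (trans (negated eq) (*-congʳ (toward-involutive left _)))

    stepAlong : Direction → Step
    stepAlong right = step (cost σ) x y
    stepAlong left  = step (cost σ) y x

    stepAlong-ordered : ∀ d → 0# ≤ dt → Displaced d → Ordered (stepAlong d)
    stepAlong-ordered right 0≤dt eq = advance right 0≤dt eq
    stepAlong-ordered left  0≤dt eq = ≤-by (x≤y⇒0≤y-x (advance left 0≤dt eq))
      (solve 2 (λ x y → x :- y := :- y :- :- x) refl x y)

    stepAlong-integral : ∀ d → Displaced d → weight (stepAlong d) * (hi (stepAlong d) - lo (stepAlong d)) ≈ dt
    stepAlong-integral right eq = begin-equality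
      cost σ * (y - x)             ≈⟨ *-congˡ eq ⟩
      cost σ * (speedValue σ * dt) ≈⟨ *-assoc _ _ _ ⟨
      cost σ * speedValue σ * dt   ≈⟨ *-congʳ (cost*speed≈1 σ) ⟩
      1# * dt                      ≈⟨ *-identityˡ dt ⟩
      dt                           ∎
    stepAlong-integral left eq = begin-equality
      cost σ * (x - y)               ≈⟨ *-congˡ (solve 2 (λ x y → x :- y := :- (y :- x)) refl x y) ⟩
      cost σ * - (y - x)             ≈⟨ *-congˡ (-‿cong eq) ⟩
      cost σ * - (- speedValue σ * dt) ≈⟨ solve 3 (λ c s t → c :* :- (:- s :* t) := c :* s :* t) refl (cost σ) (speedValue σ) dt ⟩
      cost σ * speedValue σ * dt     ≈⟨ *-congʳ (cost*speed≈1 σ) ⟩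
      1# * dt                        ≈⟨ *-identityˡ dt ⟩
      dt                             ∎

    stepAlong-nonneg : ∀ d q → 0# ≤ at (stepAlong d) q
    stepAlong-nonneg d q with lo (stepAlong d) <?≤ q | q <?≤ hi (stepAlong d)
    stepAlong-nonneg right q | inj₁ _ | inj₁ _ = 0≤cost σ
    stepAlong-nonneg left  q | inj₁ _ | inj₁ _ = 0≤cost σ
    ... | inj₁ _ | inj₂ _ = ≤-refl
    ... | inj₂ _ | _      = ≤-refl

    stepAlong-separates : ∀ d {q} → 0# ≤ dt → Displaced d → Separates q x y → at (stepAlong d) q ≈ cost σ
    stepAlong-separates right 0≤dt eq (inj₁ (x<q , q<y)) = at-inside (stepAlong right) x<q q<y
    stepAlong-separates right 0≤dt eq (inj₂ (y<q , q<x)) = ⊥-elim (<⇒≱ (<-trans y<q q<x) (stepAlong-ordered right 0≤dt eq))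
    stepAlong-separates left  0≤dt eq (inj₁ (x<q , q<y)) = ⊥-elim (<⇒≱ (<-trans x<q q<y) (stepAlong-ordered left 0≤dt eq))
    stepAlong-separates left  0≤dt eq (inj₂ (y<q , q<x)) = at-inside (stepAlong left) y<q q<x

    stepAlong-avoids : ∀ d {q} → Avoids q (stepAlong d) → ¬ q ≈ x × ¬ q ≈ y
    stepAlong-avoids right (q≉x , q≉y) = q≉x , q≉y
    stepAlong-avoids left  (q≉y , q≉x) = q≉x , q≉y

  time-mono : ∀ {m n} → m ℕ.≤ n → time m ≤ time n
  time-mono m≤n = go (ℕ.≤⇒≤′ m≤n)
    where
    go : ∀ {m n} → m ℕ.≤′ n → time m ≤ time n
    go (ℕ.≤′-reflexive ≡.refl) = ≤-refl
    go (ℕ.≤′-step m≤n) = ≤-trans (go m≤n) (inj₁ (time-increasing _))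

  0≤time : ∀ n → 0# ≤ time n
  0≤time n = ≤-trans (inj₂ (sym time-start)) (time-mono ℕ.z≤n)

  displacement : ∀ n {t u} → time n ≤ t → t ≤ u → u ≤ time (suc n) →
    position u - position t ≈ velocity (direction n) (speed n) * (u - t)
  displacement n {t} {u} n≤t t≤u u≤n = begin-equality
    position u - position t
      ≈⟨ +-cong (move n u (≤-trans n≤t t≤u) u≤n) (-‿cong (move n t n≤t (≤-trans t≤u u≤n))) ⟩
    (p + z * (u - time n)) - (p + z * (t - time n))
      ≈⟨ solve 5 (λ p z u t s → (p :+ z :* (u :- s)) :- (p :+ z :* (t :- s)) := z :* (u :- t)) refl p z u t (time n) ⟩
    z * (u - t) ∎
    where
    p z : Carrier
    p = position (time n)
    z = velocity (direction n) (speed n)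

  position-cong : ∀ n {t u} → time n ≤ t → t ≤ u → u ≤ time (suc n) → u ≤ t → position t ≈ position u
  position-cong n {t} {u} n≤t t≤u u≤n u≤t = begin-equality
    position t
      ≈⟨ +-identityʳ _ ⟨
    position t + 0#
      ≈⟨ +-congˡ (zeroʳ _) ⟨
    position t + z * 0#
      ≈⟨ +-congˡ (*-congˡ (-‿inverseʳ t)) ⟨
    position t + z * (t - t)
      ≈⟨ +-congˡ (*-congˡ (+-congʳ (antisym t≤u u≤t))) ⟩
    position t + z * (u - t)
      ≈⟨ +-congˡ (displacement n n≤t t≤u u≤n) ⟨
    position t + (position u - position t)
      ≈⟨ solve 2 (λ x y → x :+ (y :- x) := y) refl _ _ ⟩
    position u ∎
    where
    z : Carrier
    z = velocity (direction n) (speed n)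

  -- A piece of a move rather than a whole one, because the journey is cut at detection times, which
  -- may fall inside moves.
  record Segment (t u : Carrier) : Set where
    constructor segment
    field
      index    : ℕ
      index≤t  : time index ≤ t
      t≤u      : t ≤ u
      u≤index  : u ≤ time (suc index)

    moving : position u - position t ≈ velocity (direction index) (speed index) * (u - t)
    moving = displacement index index≤t t≤u u≤index

    0≤duration : 0# ≤ u - t
    0≤duration = x≤y⇒0≤y-x t≤u

    crossing : Step
    crossing = stepAlong {speed index} {position t} {position u} {u - t} (direction index)

    crossing-separates : ∀ {q} → Separates q (position t) (position u) → at crossing q ≈ cost (speed index)
    crossing-separates = stepAlong-separates (direction index) 0≤duration moving

    crossing-nonneg : ∀ q → 0# ≤ at crossing q
    crossing-nonneg = stepAlong-nonneg {speed index} {position t} {position u} {u - t} (direction index)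

    crossing-avoids : ∀ {q} → Avoids q crossing → ¬ q ≈ position t × ¬ q ≈ position u
    crossing-avoids = stepAlong-avoids {speed index} {position t} {position u} {u - t} (direction index)

  open Segment

  infixl 5 _▹_ _⧺_

  data Trajectory (s : Carrier) : Carrier → Set where
    []  : Trajectory s s
    _▹_ : ∀ {t u} → Trajectory s t → Segment t u → Trajectory s u

  _⧺_ : ∀ {s t u} → Trajectory s t → Trajectory t u → Trajectory s u
  τ ⧺ []      = τ
  τ ⧺ (υ ▹ m) = (τ ⧺ υ) ▹ m

  trajectory : ∀ {s u} → 0# ≤ s → s ≤ u → Trajectory s u
  trajectory {s} {u} 0≤s s≤u = go (proj₁ (time-unbounded u)) s≤u (inj₁ (proj₂ (time-unbounded u)))
    where
    go : ∀ n {u} → s ≤ u → u ≤ time n → Trajectory s u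
    -- Here `s ≤ u ≤ time 0 ≈ 0# ≤ s`, so the segment is degenerate.
    go zero s≤u u≤0 = [] ▹ segment 0 (≤-trans (inj₂ time-start) 0≤s) s≤u (≤-trans u≤0 (inj₁ (time-increasing 0)))
    go (suc n) {u} s≤u u≤n with time n <?≤ u | time n <?≤ s
    ... | inj₂ u≤n | _        = go n s≤u u≤n
    ... | inj₁ n<u | inj₁ n<s = [] ▹ segment n (inj₁ n<s) s≤u u≤n
    ... | inj₁ n<u | inj₂ s≤n = go n s≤n ≤-refl ▹ segment n ≤-refl (inj₁ n<u) u≤n

  crossings : ∀ {s u} → Trajectory s u → List Step
  crossings []      = []
  crossings (τ ▹ m) = crossing m ∷ crossings τ

  crossings-ordered : ∀ {s u} (τ : Trajectory s u) → All Ordered (crossings τ)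
  crossings-ordered []      = []
  crossings-ordered (τ ▹ m) = stepAlong-ordered (direction (index m)) (0≤duration m) (moving m) ∷ crossings-ordered τ

  crossings-integral : ∀ {s u} (τ : Trajectory s u) → integral (crossings τ) ≈ u - s
  crossings-integral []      = sym (-‿inverseʳ _)
  crossings-integral {s} {u} (_▹_ {t} τ m) = trans
    (+-cong (stepAlong-integral (direction (index m)) (moving m)) (crossings-integral τ))
    (solve 3 (λ s t u → (u :- t) :+ (t :- s) := u :- s) refl s t u)

  crossings-nonneg : ∀ {s u} (τ : Trajectory s u) q → 0# ≤ value (crossings τ) q
  crossings-nonneg []      q = ≤-refl
  crossings-nonneg (τ ▹ m) q = crossing-nonneg m q +≤ crossings-nonneg τ q

  crossings-⧺ : ∀ {s t u} (τ : Trajectory s t) (υ : Trajectory t u) q →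
    value (crossings (τ ⧺ υ)) q ≈ value (crossings τ) q + value (crossings υ) q
  crossings-⧺ τ []      q = sym (+-identityʳ _)
  crossings-⧺ τ (υ ▹ m) q = trans (+-congˡ (crossings-⧺ τ υ q))
    (solve 3 (λ x y z → x :+ (y :+ z) := y :+ (x :+ z)) refl _ _ _)

  ⧺-avoids : ∀ {s t u q} (τ : Trajectory s t) (υ : Trajectory t u) → All (Avoids q) (crossings (τ ⧺ υ)) →
    All (Avoids q) (crossings τ) × All (Avoids q) (crossings υ)
  ⧺-avoids τ []      avoids = avoids , []
  ⧺-avoids τ (υ ▹ m) (a ∷ avoids) = proj₁ (⧺-avoids τ υ avoids) , a ∷ proj₂ (⧺-avoids τ υ avoids)

  -- Some segment has `q` strictly between its ends, and even at full speed it contributes 1.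
  separated⇒1≤ : ∀ {s u q} (τ : Trajectory s u) → All (Avoids q) (crossings τ) →
    Separates q (position s) (position u) → 1# ≤ value (crossings τ) q
  separated⇒1≤ [] [] (inj₁ (x<q , q<x)) = ⊥-elim (<-asym x<q q<x)
  separated⇒1≤ [] [] (inj₂ (x<q , q<x)) = ⊥-elim (<-asym x<q q<x)
  separated⇒1≤ {q = q} (τ ▹ m) (a ∷ avoids) sep
    with separates-split (proj₁ (crossing-avoids m a)) sep
  ... | inj₁ sep₁ = ≤-+-nonneg (separated⇒1≤ τ avoids sep₁) (crossing-nonneg m q)
  ... | inj₂ sep₂ = ≤-trans (≤-+-nonneg {y = at (crossing m) q}
    (≤-trans (1≤cost (speed (index m))) (inj₂ (sym (crossing-separates m sep₂)))) (crossings-nonneg τ q)) (inj₂ (+-comm _ _))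

  SlowCrossing : ∀ {s u} → Carrier → Trajectory s u → Set
  SlowCrossing q [] = ⊥
  SlowCrossing q (_▹_ {t} {u} τ m) =
    SlowCrossing q τ ⊎ (speed (index m) ≡ slow × Separates q (position t) (position u))

  slow-segment : ∀ {t u q} (m : Segment t u) → speed (index m) ≡ slow →
    Separates q (position t) (position u) → w ≤ at (crossing m) q
  slow-segment m is-slow sep = ≤-trans (inj₂ (reflexive (≡.cong cost (≡.sym is-slow))))
    (inj₂ (sym (crossing-separates m sep)))

  slowCrossing⇒w≤ : ∀ {s u q} (τ : Trajectory s u) → SlowCrossing q τ → w ≤ value (crossings τ) q
  slowCrossing⇒w≤ {q = q} (τ ▹ m) (inj₁ sc) = ≤-+-nonneg (slowCrossing⇒w≤ τ sc) (crossing-nonneg m q)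
  slowCrossing⇒w≤ {q = q} (τ ▹ m) (inj₂ (is-slow , sep)) = ≤-trans
    (≤-+-nonneg {y = at (crossing m) q} (slow-segment m is-slow sep) (crossings-nonneg τ q)) (inj₂ (+-comm _ _))

  -- Returning to the original side takes an even number of crossings, so the slow one is
  -- accompanied by another. In the induction, either the slow crossing lies in a prefix that has
  -- already returned, or the prefix and the last segment contribute one crossing each.
  slow-return : ∀ {s u q} (τ : Trajectory s u) → All (Avoids q) (crossings τ) → SlowCrossing q τ →
    SameSide q (position s) (position u) → 1# + w ≤ value (crossings τ) q
  slow-return {q = q} (τ ▹ m) (a ∷ avoids) (inj₁ sc) same
    with sameSide-split (proj₁ (crossing-avoids m a)) same
  ... | inj₁ same₁ = ≤-+-nonneg (slow-return τ avoids sc same₁) (crossing-nonneg m q)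
  ... | inj₂ sep   = +-mono-≤ (≤-trans (1≤cost (speed (index m))) (inj₂ (sym (crossing-separates m sep)))) (slowCrossing⇒w≤ τ sc)
  slow-return (τ ▹ m) (a ∷ avoids) (inj₂ (is-slow , sep)) same = ≤-trans (inj₂ (+-comm 1# w))
    (+-mono-≤ (slow-segment m is-slow sep) (separated⇒1≤ τ avoids (sameSide-separates same sep)))

  -- A detection at an endpoint of a slow move need not be a crossing, since the agent may turn
  -- there. Avoiding all endpoints puts `t` strictly inside a segment; its move is then the
  -- detecting one, hence slow, and monotone motion carries it across `q`.
  detected⇒slowCrossing : ∀ {s u q t} (τ : Trajectory s u) → DetectsAt A q t → s ≤ t → t ≤ u →
    ¬ q ≈ position s → All (Avoids q) (crossings τ) → SlowCrossing q τ
  detected⇒slowCrossing [] (n , _ , n≤t , t≤n , at-q) s≤t t≤s q≉s [] = ⊥-elim (q≉s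
    (trans (sym at-q) (sym (position-cong n (≤-trans n≤t t≤s) s≤t t≤n t≤s))))
  detected⇒slowCrossing {u = u} {q} {t} (_▹_ {t₁} τ m) detects@(j , j-slow , j≤t , t≤j , at-q) s≤t t≤u′ q≉s (a ∷ avoids)
    with t₁ <?≤ t
  ... | inj₂ t≤t₁ = inj₁ (detected⇒slowCrossing τ detects s≤t t≤t₁ q≉s avoids)
  ... | inj₁ t₁<t = inj₂ (≡.subst (λ i → speed i ≡ slow) j≡index j-slow , toward-separates d
      (≤∧≉⇒< (≤-trans before (inj₂ (toward-cong d at-q))) λ eq → proj₁ q≉ (toward-injective (sym eq)))
      (≤∧≉⇒< (≤-trans (inj₂ (toward-cong d (sym at-q))) after) λ eq → proj₂ q≉ (toward-injective eq)))
    where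
    n : ℕ
    n = index m
    d : Direction
    d = direction n
    q≉ : ¬ q ≈ position t₁ × ¬ q ≈ position u
    q≉ = crossing-avoids m a
    t<u : t < u
    t<u with t <?≤ u
    ... | inj₁ t<u = t<u
    ... | inj₂ u≤t = ⊥-elim (proj₂ q≉ (trans (sym at-q)
            (position-cong n (≤-trans (index≤t m) (inj₁ t₁<t)) t≤u′ (u≤index m) u≤t)))
    j≡index : j ≡ n
    j≡index with ℕ.<-cmp j n
    ... | tri< j<n _ _ = ⊥-elim (<⇒≱ (≤-<-trans (≤-trans (time-mono j<n) (index≤t m)) t₁<t) t≤j)
    ... | tri≈ _ j≡n _ = j≡n
    ... | tri> _ _ n<j = ⊥-elim (<⇒≱ (<-≤-trans t<u (≤-trans (u≤index m) (time-mono n<j))) j≤t)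
    before : toward d (position t₁) ≤ toward d (position t)
    before = advance d (x≤y⇒0≤y-x (inj₁ t₁<t))
      (displacement n (index≤t m) (inj₁ t₁<t) (≤-trans t≤u′ (u≤index m)))
    after : toward d (position t) ≤ toward d (position u)
    after = advance d (x≤y⇒0≤y-x t≤u′)
      (displacement n (≤-trans (index≤t m) (inj₁ t₁<t)) t≤u′ (u≤index m))
    toward-injective : ∀ {x y} → toward d x ≈ toward d y → x ≈ y
    toward-injective {x} {y} eq = trans (sym (toward-involutive d x)) (trans (toward-cong d eq) (toward-involutive d y))

  unit-speed : ∀ {s u} e → Trajectory s u → toward e (position u) - toward e (position s) ≤ u - s
  unit-speed e [] = inj₂ (trans (-‿inverseʳ _) (sym (-‿inverseʳ _)))
  unit-speed {s} {u} e (_▹_ {t} τ m) = ≤-by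
    (x≤y⇒0≤y-x (advance-at-most (direction (index m)) e (0≤duration m) (moving m)) +≤ x≤y⇒0≤y-x (unit-speed e τ))
    (solve 6 (λ s t u x y z → (u :- s) :- (z :- x) := ((u :- t) :- (z :- y)) :+ ((t :- s) :- (y :- x))) refl
      s t u (toward e (position s)) (toward e (position t)) (toward e (position u)))

  position-bound : ∀ e {t} → 0# ≤ t → toward e (position t) ≤ t
  position-bound e {t} 0≤t = ≤-by (x≤y⇒0≤y-x (unit-speed e (trajectory ≤-refl 0≤t))) (begin-equality
    t - toward e (position t)
      ≈⟨ solve 2 (λ t y → t :- y := (t :- :0) :- (y :- :0)) refl t (toward e (position t)) ⟩
    (t - 0#) - (toward e (position t) - 0#)
      ≈⟨ +-congˡ (-‿cong (+-congˡ (-‿cong (trans (toward-cong e position-start) (toward-0 e))))) ⟨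
    (t - 0#) - (toward e (position t) - toward e (position 0#)) ∎)

-- The alternating targets and the regions swept between them.

module Phases (em : ExcludedMiddle 0ℓ) (ℝ : CompleteOrderedField) (v : CompleteOrderedField.Carrier ℝ)
  (0<v : CompleteOrderedField._<_ ℝ (CompleteOrderedField.0# ℝ) v)
  (v<1 : CompleteOrderedField._<_ ℝ v (CompleteOrderedField.1# ℝ))
  (A : LinearSearch.SearchAlgorithm ℝ v) where

  open CompleteOrderedField ℝ
  open OrderedField ℝ
  open StepFunction ℝ
  open Sides ℝ
  open LinearSearch ℝ v
  open SearchAlgorithm A
  open Trajectories ℝ v 0<v v<1 A
  open OrderReasoning hiding (start)

  byContradiction : {P : Set} → ¬ ¬ P → P
  byContradiction = decidable-stable em

  byCases : (P : Set) {Q : Set} → (P → Q) → (¬ P → Q) → Q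
  byCases P p⇒q ¬p⇒q = Sum.[ p⇒q , ¬p⇒q ]′ (toSum (em {P}))

  DetectedBy : Carrier → Pred Carrier 0ℓ
  DetectedBy s x = ∃[ t ] (t ≤ s × DetectsAt A x t)

  -- No target is nearer than 1, which explains the lower limit; the strict upper limit makes the
  -- supremum of covered extents a covered extent itself.
  Covered : Direction → Carrier → Carrier → Set
  Covered e y s = ∀ z → 1# ≤ z → z < y → DetectedBy s (toward e z)

  covered-later : ∀ e {y s t} → s ≤ t → Covered e y s → Covered e y t
  covered-later e s≤t covered z 1≤z z<y with covered z 1≤z z<y
  ... | t′ , t′≤s , detects = t′ , ≤-trans t′≤s s≤t , detects

  detection-nonneg : ∀ {x t} → DetectsAt A x t → 0# ≤ t
  detection-nonneg (n , _ , n≤t , _) = ≤-trans (0≤time n) n≤t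

  detected-within-time : ∀ e {z s} → DetectedBy s (toward e z) → z ≤ s
  detected-within-time e {z} {s} (t , t≤s , detects@(_ , _ , _ , _ , at-z)) = begin
    z                        ≈⟨ toward-involutive e z ⟨
    toward e (toward e z)    ≈⟨ toward-cong e at-z ⟨
    toward e (position t)    ≤⟨ position-bound e (detection-nonneg detects) ⟩
    t                        ≤⟨ t≤s ⟩
    s                        ∎

  module _ {κ : Carrier} (1<κ : 1# < κ) where

    -- The point at `limit` may already have been detected, so the next target is `hidden`, up to a
    -- factor `κ` further out.
    record Frontier (e : Direction) (y₀ s : Carrier) : Set where
      field
        limit          : Carrier
        y₀≤limit       : y₀ ≤ limit
        1≤limit        : 1# ≤ limit
        covered        : Covered e limit s
        hidden         : Carrier
        limit≤hidden   : limit ≤ hidden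
        hidden≤κ*limit : hidden ≤ κ * limit
        undetected     : ¬ DetectedBy s (toward e hidden)

    module _ (e : Direction) {y₀ s : Carrier} (0≤s : 0# ≤ s) (covered₀ : Covered e y₀ s) where

      private
        -- With speed at most 1, nothing at distance `s + 1#` is detected by time `s`; the added 1
        -- makes this an admissible distance.
        bound : IsUpperBound _≤_ (λ y → Covered e y s) (s + 1#)
        bound y covered = ≮⇒≥ λ s+1<y → <⇒≱
          (<-by 0<1 (solve 1 (λ s → s :+ :1 :- s := :1) refl s))
          (detected-within-time e (covered (s + 1#)
            (≤-by 0≤s (solve 1 (λ s → s :+ :1 :- :1 := s) refl s)) s+1<y))

        supremum : ∃ (IsSupremum _≤_ (λ y → Covered e y s))
        supremum = complete (λ y → Covered e y s) (y₀ , covered₀) (s + 1# , bound)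

        sup : Carrier
        sup = proj₁ supremum

        upper : IsUpperBound _≤_ (λ y → Covered e y s) sup
        upper = proj₁ (proj₂ supremum)

        least : ∀ b → IsUpperBound _≤_ (λ y → Covered e y s) b → sup ≤ b
        least = proj₂ (proj₂ supremum)

        1≤sup : 1# ≤ sup
        1≤sup = upper 1# λ z 1≤z z<1 → ⊥-elim (<⇒≱ z<1 1≤z)

        sup-covered : Covered e sup s
        sup-covered z 1≤z z<sup = byContradiction λ undetected → <⇒≱ z<sup (least z
          λ y covered → ≮⇒≥ λ z<y → undetected (covered z 1≤z z<y))

        sup<κ*sup : sup < κ * sup
        sup<κ*sup = <-by (*-pos (x<y⇒0<y-x 1<κ) (<-≤-trans 0<1 1≤sup))
          (solve 2 (λ k x → k :* x :- x := (k :- :1) :* x) refl κ sup)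

        -- Otherwise `κ * sup` would be a covered extent larger than the supremum.
        hidden-point : ∃[ z ] (1# ≤ z × z < κ * sup × ¬ DetectedBy s (toward e z))
        hidden-point = byContradiction λ none → <⇒≱ sup<κ*sup (upper (κ * sup)
          λ z 1≤z z<κ*sup → byContradiction λ undetected → none (z , 1≤z , z<κ*sup , undetected))

      frontier : Frontier e y₀ s
      frontier = let z , 1≤z , z<κ*sup , undetected = hidden-point in record
        { limit          = sup
        ; y₀≤limit       = upper y₀ covered₀
        ; 1≤limit        = 1≤sup
        ; covered        = sup-covered
        ; hidden         = z
        ; limit≤hidden   = ≮⇒≥ λ z<sup → undetected (sup-covered z 1≤z z<sup)
        ; hidden≤κ*limit = inj₁ z<κ*sup
        ; undetected     = undetected
        }

    -- At its start the agent is on side d, beyond near, and next it has to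
    -- find the target on the other side.
    record Phase (d : Direction) : Set where
      field
        start near far target : Carrier
        0≤start      : 0# ≤ start
        0≤near       : 0# ≤ near
        1≤far        : 1# ≤ far
        beyond       : near ≤ toward d (position start)
        covered-near : Covered d near start
        covered-far  : Covered (opposite d) far start
        far≤target   : far ≤ target
        target≤κ*far : target ≤ κ * far
        undetected   : ∀ t → DetectsAt A (toward (opposite d) target) t → start ≤ t

    open Phase

    -- The extents 0 and 1 are covered vacuously, and the first target is the point -1.
    initial : Phase right
    initial = record
      { start        = 0#
      ; near         = 0#
      ; far          = 1#
      ; target       = 1#
      ; 0≤start      = ≤-refl
      ; 0≤near       = ≤-refl
      ; 1≤far        = ≤-refl
      ; beyond       = inj₂ (sym position-start)
      ; covered-near = λ z 1≤z z<0 → ⊥-elim (<⇒≱ (<-trans z<0 0<1) 1≤z)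
      ; covered-far  = λ z 1≤z z<1 → ⊥-elim (<⇒≱ z<1 1≤z)
      ; far≤target   = ≤-refl
      ; target≤κ*far = ≤-trans (inj₁ 1<κ) (inj₂ (sym (*-identityʳ κ)))
      ; undetected   = λ t → detection-nonneg
      }

    module _ {r : Carrier} (0≤r : 0# ≤ r)
      (detected : ∀ e z → 1# ≤ z → ∃[ t ] (DetectsAt A (toward e z) t × t ≤ r * z)) where

      module Next {d : Direction} (φ : Phase d) where

        detection : ∃[ t ] (DetectsAt A (toward (opposite d) (target φ)) t × t ≤ r * target φ)
        detection = detected (opposite d) (target φ) (≤-trans (1≤far φ) (far≤target φ))

        start′ : Carrier
        start′ = proj₁ detection

        detects : DetectsAt A (toward (opposite d) (target φ)) start′
        detects = proj₁ (proj₂ detection)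

        start≤start′ : start φ ≤ start′
        start≤start′ = undetected φ start′ detects

        start′≤ : start′ ≤ r * κ * far φ
        start′≤ = ≤-trans (proj₂ (proj₂ detection)) (≤-by (0≤r *≤ x≤y⇒0≤y-x (target≤κ*far φ))
          (solve 4 (λ r k f t → r :* k :* f :- r :* t := r :* (k :* f :- t)) refl r κ (far φ) (target φ)))

        F : Frontier d (near φ) start′
        F = frontier d (≤-trans (0≤start φ) start≤start′) (covered-later d start≤start′ (covered-near φ))

        module F = Frontier F

        next : Phase (opposite d)
        next = record
          { start        = start′
          -- The extent as it stood when the target was chosen is kept, even if more of that side is
          -- detected by `start′`: only this much is known to be behind the agent.
          ; near         = far φ
          ; far          = F.limit
          ; target       = F.hidden
          ; 0≤start      = ≤-trans (0≤start φ) start≤start′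
          ; 0≤near       = ≤-trans (inj₁ 0<1) (1≤far φ)
          ; 1≤far        = F.1≤limit
          ; beyond       = ≤-trans (far≤target φ) (inj₂ (sym (trans
                             (toward-cong (opposite d) (proj₂ (proj₂ (proj₂ (proj₂ detects)))))
                             (toward-involutive (opposite d) (target φ)))))
          ; covered-near = covered-later (opposite d) start≤start′ (covered-far φ)
          ; covered-far  = ≡.subst (λ e → Covered e F.limit start′) (≡.sym (opposite-involutive d)) F.covered
          ; far≤target   = F.limit≤hidden
          ; target≤κ*far = F.hidden≤κ*limit
          ; undetected   = λ t detects-t → ≮⇒≥ λ t<start′ → F.undetected (t , inj₁ t<start′ ,
                             ≡.subst (λ e → DetectsAt A (toward e F.hidden) t) (opposite-involutive d) detects-t)
          }

      side-of : ℕ → Direction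
      side-of zero    = right
      side-of (suc n) = opposite (side-of n)

      phase : ∀ n → Phase (side-of n)
      phase zero    = initial
      phase (suc n) = Next.next (phase n)

      Inside : ∀ {d} → Phase d → Pred Carrier 0ℓ
      Inside {d} φ q = - far φ < toward d q × toward d q < near φ

      module _ {d : Direction} (φ : Phase d) (q : Carrier) where
        open Next φ

        position′≤ : toward d (position start′) ≤ - far φ
        position′≤ = begin
          toward d (position start′)                 ≈⟨ solve 1 (λ x → x := :- (:- x)) refl _ ⟩
          - - toward d (position start′)             ≈⟨ -‿cong (toward-opposite d (position start′)) ⟨
          - toward (opposite d) (position start′)    ≤⟨ neg-mono-≤ (beyond next) ⟩
          - far φ                                    ∎

        inside-next⇒ : Inside next q → - far φ < toward d q × toward d q < F.limit
        inside-next⇒ (-limit<q , q<far) =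
          neg-cancel-< (≤-<-trans (inj₂ (sym (toward-opposite d q))) (<-≤-trans q<far
            (inj₂ (solve 1 (λ x → x := :- (:- x)) refl (far φ))))) ,
          neg-cancel-< (<-≤-trans -limit<q (inj₂ (toward-opposite d q)))

        inside-next : Inside φ q → Inside next q
        inside-next (-far<q , q<near) =
          <-≤-trans (neg-mono-< (<-≤-trans q<near F.y₀≤limit)) (inj₂ (sym (toward-opposite d q))) ,
          ≤-<-trans (inj₂ (toward-opposite d q)) (<-≤-trans (neg-mono-< -far<q)
            (inj₂ (solve 1 (λ x → :- (:- x) := x) refl (far φ))))

        inside⇒separates : Inside φ q → Separates q (position (start φ)) (position start′)
        inside⇒separates (-far<q , q<near) = swap (toward-separates d
          (≤-<-trans position′≤ -far<q) (<-≤-trans q<near (beyond φ)))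

        -- A point entering the searched region has been detected, and the agent
        -- is back on the side of the point on which it was at time 0#.
        newly-inside : ¬ Inside φ q → Inside next q → ¬ (- 1# < q × q < 1#) →
          SameSide q (position 0#) (position start′) × DetectedBy start′ q
        newly-inside outside inside′ not-unit =
          toward-sameSide d (≤-<-trans (inj₂ (trans (toward-cong d position-start) (toward-0 d))) 0<z)
            (≤-<-trans position′≤ -far<z) ,
          detected-q
          where
          z : Carrier
          z = toward d q
          -far<z : - far φ < z
          -far<z = proj₁ (inside-next⇒ inside′)
          near≤z : near φ ≤ z
          near≤z = ≮⇒≥ λ z<near → outside (-far<z , z<near)
          unit : ∀ d → - 1# < toward d q × toward d q < 1# → - 1# < q × q < 1#
          unit left  (l , u) = <-≤-trans (neg-mono-< u) (inj₂ (toward-involutive left q)) , neg-cancel-< l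
          unit right (l , u) = l , u
          1≤z : 1# ≤ z
          1≤z = ≮⇒≥ λ z<1 → not-unit (unit d (<-≤-trans (<-by 0<1 (solve 0 (:0 :- :- :1 := :1) refl))
            (≤-trans (0≤near φ) near≤z) , z<1))
          0<z : 0# < z
          0<z = <-≤-trans 0<1 1≤z
          detected-q : DetectedBy start′ q
          detected-q =
            let t , t≤ , n , is-slow , n≤t , t≤n , at-z = F.covered z 1≤z (proj₂ (inside-next⇒ inside′))
            in t , t≤ , n , is-slow , n≤t , t≤n , trans at-z (toward-involutive d q)

      region : Carrier → ∀ {d} → Phase d → Step
      region c {right} φ = step c (- far φ) (near φ)
      region c {left}  φ = step c (- near φ) (far φ)

      region-inside : ∀ c {d} (φ : Phase d) {q} → Inside φ q → at (region c φ) q ≈ c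
      region-inside c {right} φ (l , u) = at-inside (region c φ) l u
      region-inside c {left}  φ {q} (l , u) = at-inside (region c φ)
        (<-≤-trans (neg-mono-< u) (inj₂ (toward-involutive left q))) (neg-cancel-< l)

      region-outside : ∀ c {d} (φ : Phase d) {q} → ¬ Inside φ q → at (region c φ) q ≈ 0#
      region-outside c {right} φ outside = at-outside (region c φ) outside
      region-outside c {left}  φ {q} outside = at-outside (region c φ) λ (l , u) → outside
        (neg-mono-< u , <-≤-trans (neg-mono-< l) (inj₂ (toward-involutive left (near φ))))

      region-ordered : ∀ c {d} (φ : Phase d) → Ordered (region c φ)
      region-ordered c {right} φ = ≤-by (0≤near φ +≤ ≤-trans (inj₁ 0<1) (1≤far φ))
        (solve 2 (λ n f → n :- :- f := n :+ f) refl (near φ) (far φ))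
      region-ordered c {left}  φ = ≤-by (0≤near φ +≤ ≤-trans (inj₁ 0<1) (1≤far φ))
        (solve 2 (λ n f → f :- :- n := n :+ f) refl (near φ) (far φ))

      region-integral : ∀ c {d} (φ : Phase d) →
        Step.weight (region c φ) * (Step.hi (region c φ) - Step.lo (region c φ)) ≈ c * (near φ + far φ)
      region-integral c {right} φ = solve 3 (λ c n f → c :* (n :- :- f) := c :* (n :+ f)) refl c (near φ) (far φ)
      region-integral c {left}  φ = solve 3 (λ c n f → c :* (f :- :- n) := c :* (n :+ f)) refl c (near φ) (far φ)

      -- Balancing the time spent at each point against the sweeps.

      journey : ∀ n → Trajectory 0# (start (phase n))
      journey zero    = []
      journey (suc n) = journey n ⧺ trajectory (0≤start (phase n)) (Next.start≤start′ (phase n))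

      -- One passage is charged for each region `k < n`. Region `n` is missing, as it is swept only
      -- after the start of phase `n`.
      sweeps : ℕ → List Step
      sweeps zero    = []
      sweeps (suc n) = region (- 1#) (phase n) ∷ sweeps n

      swept : ℕ → Carrier
      swept zero    = 0#
      swept (suc n) = swept n + (near (phase n) + far (phase n))

      sweeps-ordered : ∀ n → All Ordered (sweeps n)
      sweeps-ordered zero    = []
      sweeps-ordered (suc n) = region-ordered _ (phase n) ∷ sweeps-ordered n

      sweeps-integral : ∀ n → integral (sweeps n) ≈ - swept n
      sweeps-integral zero    = solve 0 (:0 := :- :0) refl
      sweeps-integral (suc n) = trans (+-cong (region-integral (- 1#) (phase n)) (sweeps-integral n))
        (solve 2 (λ x y → (:- :1) :* x :+ :- y := :- (y :+ x)) refl _ (swept n))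

      -- The regions increase, so a point outside the latest one has never been charged.
      sweeps-outside : ∀ n {q} → ¬ Inside (phase n) q → value (sweeps (suc n)) q ≈ 0#
      sweeps-outside n {q} outside = trans
        (+-cong (region-outside (- 1#) (phase n) outside) (earlier n outside)) (+-identityˡ 0#)
        where
        earlier : ∀ n → ¬ Inside (phase n) q → value (sweeps n) q ≈ 0#
        earlier zero    outside = refl
        earlier (suc n) outside = sweeps-outside n λ inside → outside (inside-next (phase n) q inside)

      -- The cost at `q` in excess of the unit charged for each completed sweep.
      spent : ℕ → Carrier → Carrier
      spent n q = value (crossings (journey n)) q + value (sweeps n) q

      -- The new leg crosses `q`, which pays for the new charge.
      spent-inside : ∀ n {q} → All (Avoids q) (crossings (journey (suc n))) → Inside (phase n) q →
        spent n q ≤ spent (suc n) q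
      spent-inside n {q} avoids inside = ≤-by (x≤y⇒0≤y-x
        (separated⇒1≤ leg (proj₂ (⧺-avoids (journey n) leg avoids)) (inside⇒separates (phase n) q inside)))
        (begin-equality
          (value (crossings (journey n ⧺ leg)) q + (at (region (- 1#) (phase n)) q + C)) - (J + C)
            ≈⟨ +-congʳ (+-cong (crossings-⧺ (journey n) leg q) (+-congʳ (region-inside (- 1#) (phase n) inside))) ⟩
          ((J + L) + (- 1# + C)) - (J + C)
            ≈⟨ solve 3 (λ J L C → ((J :+ L) :+ (:- :1 :+ C)) :- (J :+ C) := L :- :1) refl J L C ⟩
          L - 1# ∎)
        where
        leg : Trajectory (start (phase n)) (start (phase (suc n)))
        leg = trajectory (0≤start (phase n)) (Next.start≤start′ (phase n))
        J L C : Carrier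
        J = value (crossings (journey n)) q
        L = value (crossings leg) q
        C = value (sweeps n) q

      avoids-earlier : ∀ n {q} → All (Avoids q) (crossings (journey (suc n))) → All (Avoids q) (crossings (journey n))
      avoids-earlier n avoids = proj₁ (⧺-avoids (journey n) _ avoids)

      spent-nonneg : ∀ n {q} → All (Avoids q) (crossings (journey n)) → 0# ≤ spent n q
      spent-nonneg zero    avoids = ≤-refl +≤ ≤-refl
      spent-nonneg (suc n) {q} avoids = byCases (Inside (phase n) q)
        (λ inside → ≤-trans (spent-nonneg n (avoids-earlier n avoids)) (spent-inside n avoids inside))
        λ outside → crossings-nonneg (journey (suc n)) q +≤ inj₂ (sym (sweeps-outside n outside))

      -- When `q` enters the region nothing has been charged to it, while the journey from the
      -- origin contains a slow crossing and a return. Later phases never lower the excess.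
      spent-region : ∀ n {q} → All (Avoids q) (crossings (journey n)) → Inside (phase n) q →
        ¬ (- 1# < q × q < 1#) → 1# + w ≤ spent n q
      -- The initial region is (-1, 0).
      spent-region zero    avoids (l , u) not-unit = ⊥-elim (not-unit (l , <-trans u 0<1))
      spent-region (suc n) {q} avoids inside′ not-unit = byCases (Inside (phase n) q)
        (λ inside → ≤-trans (spent-region n (avoids-earlier n avoids) inside not-unit) (spent-inside n avoids inside))
        λ outside →
          let same , t , t≤ , detects = newly-inside (phase n) q outside inside′ not-unit
          in ≤-trans
            (slow-return τ avoids (detected⇒slowCrossing τ detects (detection-nonneg detects) t≤ (apart same) avoids) same)
            (inj₂ (sym (trans (+-congˡ (sweeps-outside n outside)) (+-identityʳ _))))
        where
        τ : Trajectory 0# (start (phase (suc n)))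
        τ = journey (suc n)
        apart : ∀ {x y} → SameSide q x y → ¬ q ≈ x
        apart (inj₁ (x<q , _)) q≈x = <-irrefl (sym q≈x) x<q
        apart (inj₂ (q<x , _)) q≈x = <-irrefl q≈x q<x

      0≤c : 0# ≤ 1# + w
      0≤c = inj₁ 0<1 +≤ ≤-trans (inj₁ 0<1) 1≤w

      unitStep : Step
      unitStep = step (1# + w) (- 1#) 1#

      -- The excess minus `1# + w` on the current region, refunded on (-1, 1), where no detection is
      -- guaranteed.
      balance : ℕ → List Step
      balance n = crossings (journey n) ++ region (- (1# + w)) (phase n) ∷ unitStep ∷ sweeps n

      balance-ordered : ∀ n → All Ordered (balance n)
      balance-ordered n = All.++⁺ (crossings-ordered (journey n))
        (region-ordered _ (phase n) ∷
         ≤-by (inj₁ 0<2) (solve 0 (:1 :- :- :1 := :1 :+ :1) refl) ∷ sweeps-ordered n)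

      balance-nonneg : ∀ n q → All (Avoids q) (balance n) → 0# ≤ value (balance n) q
      balance-nonneg n q avoids = ≤-trans by-cases (inj₂ (sym (trans
        (value-++ (crossings (journey n)) _ q)
        (solve 4 (λ J x y C → J :+ (x :+ (y :+ C)) := (J :+ C) :+ (x :+ y)) refl _ _ _ _))))
        where
        avoids-journey : All (Avoids q) (crossings (journey n))
        avoids-journey = All.++⁻ˡ (crossings (journey n)) avoids
        c : Carrier
        c = 1# + w
        nonneg : 0# ≤ spent n q
        nonneg = spent-nonneg n avoids-journey
        by-cases : 0# ≤ spent n q + (at (region (- c) (phase n)) q + at unitStep q)
        by-cases = byCases (Inside (phase n) q)
          (λ inside → byCases (- 1# < q × q < 1#)
            (λ (l , u) → nonneg +≤ inj₂ (sym (trans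
              (+-cong (region-inside (- c) (phase n) inside) (at-inside unitStep l u)) (-‿inverseˡ c))))
            λ not-unit → ≤-trans
              (x≤y⇒0≤y-x (spent-region n avoids-journey inside not-unit))
              (inj₂ (+-congˡ (sym (trans (+-cong (region-inside (- c) (phase n) inside) (at-outside unitStep not-unit))
                (+-identityʳ (- c)))))))
          λ outside → nonneg +≤ (inj₂ (sym (region-outside (- c) (phase n) outside)) +≤
            byCases (- 1# < q × q < 1#)
              (λ (l , u) → ≤-trans 0≤c (inj₂ (sym (at-inside unitStep l u))))
              λ not-unit → inj₂ (sym (at-outside unitStep not-unit)))

      -- The integrated `balance`: the journey contributes the elapsed time, and the refund
      -- `unitStep` the constant `2# * (1# + w)`.
      start-lower-bound : ∀ n →
        swept n + (1# + w) * (near (phase n) + far (phase n)) ≤ start (phase n) + 2# * (1# + w)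
      start-lower-bound n = ≤-by (integral-nonneg (balance-ordered n) (balance-nonneg n)) (sym (begin-equality
        integral (balance n)
          ≈⟨ integral-++ (crossings (journey n)) _ ⟩
        integral (crossings (journey n)) + (_ + (c * (1# - - 1#) + integral (sweeps n)))
          ≈⟨ +-cong (crossings-integral (journey n)) (+-cong (region-integral (- c) (phase n)) (+-congˡ (sweeps-integral n))) ⟩
        (start (phase n) - 0#) + (- c * ℓ + (c * (1# - - 1#) + - swept n))
          ≈⟨ solve 4 (λ s c l x → (s :- :0) :+ (:- c :* l :+ (c :* (:1 :- :- :1) :+ :- x)) :=
               (s :+ (:1 :+ :1) :* c) :- (x :+ c :* l)) refl (start (phase n)) c ℓ (swept n) ⟩
        (start (phase n) + 2# * c) - (swept n + c * ℓ) ∎))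
        where
        c ℓ : Carrier
        c = 1# + w
        ℓ = near (phase n) + far (phase n)

      -- Partial sums of the extents; the initial value absorbs the constant of `start-lower-bound`
      -- and makes the recurrence homogeneous.
      S : ℕ → Carrier
      S zero    = - (1# + w)
      S (suc n) = S n + near (phase (suc n))

      -- Each extent bounds two consecutive regions, first as `far` and then as `near`; the last one
      -- has been counted only once.
      swept-S : ∀ n → swept n ≈ 2# * (S n + (1# + w)) - near (phase n)
      swept-S zero    = solve 1 (λ c → :0 := (:1 :+ :1) :* (:- c :+ c) :- :0) refl (1# + w)
      swept-S (suc n) = trans (+-congʳ (swept-S n))
        (solve 4 (λ S c y z → ((:1 :+ :1) :* (S :+ c) :- y) :+ (y :+ z) := (:1 :+ :1) :* (S :+ z :+ c) :- z) refl
          (S n) (1# + w) (near (phase n)) (far (phase n)))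

      S-increasing : ∀ n → S n + 1# ≤ S (suc n)
      S-increasing n = ≤-by (x≤y⇒0≤y-x (1≤far (phase n)))
        (solve 2 (λ S y → (S :+ y) :- (S :+ :1) := y :- :1) refl (S n) (far (phase n)))

      -- The start of phase `suc n` is squeezed between the time allowed for finding the preceding
      -- target and the time the sweeps require, and cancels.
      S-recurrence : ∀ n → 2# * S (suc n) + (1# + w) * (S (suc (suc n)) - S n)
                             ≤ (r * κ + 1#) * (S (suc n) - S n)
      S-recurrence n = ≤-by
        (x≤y⇒0≤y-x (Next.start′≤ (phase n)) +≤ x≤y⇒0≤y-x (start-lower-bound (suc n)))
        (sym (begin-equality
          (r * κ * y - s) + ((s + 2# * c) - (swept (suc n) + c * (y + y′)))
            ≈⟨ +-congˡ (+-congˡ (-‿cong (+-congʳ (swept-S (suc n))))) ⟩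
          (r * κ * y - s) + ((s + 2# * c) - ((2# * (S n + y + c) - y) + c * (y + y′)))
            ≈⟨ solve 6 (λ ρ y y′ s c S →
                 (ρ :* y :- s) :+ ((s :+ (:1 :+ :1) :* c) :- (((:1 :+ :1) :* (S :+ y :+ c) :- y) :+ c :* (y :+ y′)))
                 := (ρ :+ :1) :* ((S :+ y) :- S) :- ((:1 :+ :1) :* (S :+ y) :+ c :* ((S :+ y :+ y′) :- S)))
                 refl (r * κ) y y′ s c (S n) ⟩
          (r * κ + 1#) * ((S n + y) - S n) - (2# * (S n + y) + c * ((S n + y + y′) - S n)) ∎))
        where
        c y y′ s : Carrier
        c = 1# + w
        y = near (phase (suc n))
        y′ = far (phase (suc n))
        s = start (phase (suc n))

      no-fast-detection : ∀ {σ} → 0# ≤ σ → σ * σ ≈ 2# * (1# + w) → ¬ r * κ < 1# + 2# * ((1# + w) + σ)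
      no-fast-detection 0≤σ σ²≈2c rκ<R = GrowthRecurrence.absurd ℝ
        (≤-by (≤-trans (inj₁ 0<1) 1≤w) (solve 1 (λ w → :1 :+ w :- :1 := w) refl w))
        0≤σ σ²≈2c rκ<R S S-increasing S-recurrence

-- From the competitive ratio to detection within a bounded time.

module DetectionTimes (em : ExcludedMiddle 0ℓ) (ℝ : CompleteOrderedField) (v : CompleteOrderedField.Carrier ℝ)
  (0<v : CompleteOrderedField._<_ ℝ (CompleteOrderedField.0# ℝ) v)
  (v<1 : CompleteOrderedField._<_ ℝ v (CompleteOrderedField.1# ℝ))
  (A : LinearSearch.SearchAlgorithm ℝ v) where

  open CompleteOrderedField ℝ
  open OrderedField ℝ
  open Sides ℝ
  open LinearSearch ℝ v
  open SearchAlgorithm A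
  open Trajectories ℝ v 0<v v<1 A
  open Phases em ℝ v 0<v v<1 A
  open OrderReasoning

  DetectsDuring : Carrier → ℕ → Carrier → Set
  DetectsDuring x n t = speed n ≡ slow × time n ≤ t × t ≤ time (suc n) × position t ≈ x

  slow-moves-away : ∀ d {σ x y dt} → 0# < dt → y - x ≈ velocity d σ * dt → ¬ x ≈ y
  slow-moves-away d {σ} {x} {y} {dt} 0<dt moved x≈y = <-irrefl (sym s*dt≈0) (*-pos (0<speed σ) 0<dt)
    where
    y-x≈0 : y - x ≈ 0#
    y-x≈0 = trans (+-congˡ (-‿cong x≈y)) (-‿inverseʳ y)
    s*dt≈0′ : ∀ d → y - x ≈ velocity d σ * dt → speedValue σ * dt ≈ 0#
    s*dt≈0′ right moved = trans (sym moved) y-x≈0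
    s*dt≈0′ left  moved = begin-equality
      speedValue σ * dt        ≈⟨ solve 2 (λ s t → s :* t := :- (:- s :* t)) refl (speedValue σ) dt ⟩
      - (- speedValue σ * dt)  ≈⟨ -‿cong (trans (sym moved) y-x≈0) ⟩
      - 0#                     ≈⟨ solve 0 (:- :0 := :0) refl ⟩
      0#                       ∎
    s*dt≈0 : speedValue σ * dt ≈ 0#
    s*dt≈0 = s*dt≈0′ d moved

  -- A single move meets a point at most once, so the detection in the least detecting move is the
  -- earliest; no infimum of times has to be shown attained.
  first-detection : ∀ {x} → ∃ (DetectsAt A x) → ∃[ t ] IsDetectionTime A x [ t ]
  first-detection {x} (t₀ , n₀ , during₀) = t , (n , during) , earliest
    where
    Detecting : Pred ℕ 0ℓ
    Detecting n = ∃ (DetectsDuring x n)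

    least : ∃[ n ] (Detecting n × (∀ j → j ℕ.< n → ¬ Detecting j))
    least = byContradiction λ none →
      <-rec (λ n → ¬ Detecting n) (λ n earlier now → none (n , now , λ j → earlier {j})) n₀ (t₀ , during₀)

    n : ℕ
    n = proj₁ least
    t : Carrier
    t = proj₁ (proj₁ (proj₂ least))
    during : DetectsDuring x n t
    during = proj₂ (proj₁ (proj₂ least))

    earliest : ∀ s → DetectsAt A x s → t ≤ s
    earliest s (m , during′@(_ , m≤s , s≤m , s-at)) = compareMoves (ℕ.<-cmp m n)
      where
      n≤t : time n ≤ t
      n≤t = proj₁ (proj₂ during)
      t≤n : t ≤ time (suc n)
      t≤n = proj₁ (proj₂ (proj₂ during))
      compareMoves : _ → t ≤ s
      compareMoves (tri< m<n _ _) = ⊥-elim (proj₂ (proj₂ least) m m<n (s , during′))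
      compareMoves (tri≈ _ ≡.refl _) = ≮⇒≥ λ s<t → slow-moves-away (direction n) (x<y⇒0<y-x s<t)
        (displacement n m≤s (inj₁ s<t) t≤n) (trans s-at (sym (proj₂ (proj₂ (proj₂ during)))))
      compareMoves (tri> _ _ n<m) = ≤-trans t≤n (≤-trans (time-mono n<m) m≤s)

  abs-toward : ∀ e {z} → 1# ≤ z → ∣ toward e z ∣ ≈ z
  abs-toward right {z} 1≤z with compare z 0#
  ... | tri< z<0 _ _ = ⊥-elim (<⇒≱ (<-trans z<0 0<1) 1≤z)
  ... | tri≈ _ _ _   = refl
  ... | tri> _ _ _   = refl
  abs-toward left {z} 1≤z with compare (- z) 0#
  ... | tri< _ _ _    = toward-involutive left z
  ... | tri≈ -z≮0 _ _ = ⊥-elim (-z≮0 (<-by (<-≤-trans 0<1 1≤z) (solve 1 (λ z → :0 :- :- z := z) refl z)))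
  ... | tri> -z≮0 _ _ = ⊥-elim (-z≮0 (<-by (<-≤-trans 0<1 1≤z) (solve 1 (λ z → :0 :- :- z := z) refl z)))

  -- A target that is never detected would have the ratio `⊤⁺`, which no finite bound admits; hence
  -- a first detection exists, and its ratio is at most `r`.
  detection-within-ratio : ∀ {r} → IsUpperBound _≤⁺_ (IsRatio A) [ r ] →
    ∀ e z → 1# ≤ z → ∃[ t ] (DetectsAt A (toward e z) t × t ≤ r * z)
  detection-within-ratio {r} upper e z 1≤z = t , proj₁ (proj₂ first) , in-time (upper _
      (x , [ t ] , 1≤∣x∣ , proj₂ first , ≡.refl))
    where
    x : Carrier
    x = toward e z
    ∣x∣≈z : ∣ x ∣ ≈ z
    ∣x∣≈z = abs-toward e 1≤z
    1≤∣x∣ : 1# ≤ ∣ x ∣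
    1≤∣x∣ = ≤-trans 1≤z (inj₂ (sym ∣x∣≈z))
    ⊤⁺≰ : ¬ ⊤⁺ ≤⁺ [ r ]
    ⊤⁺≰ ()
    first : ∃[ t ] IsDetectionTime A x [ t ]
    first = first-detection (byContradiction λ never → ⊤⁺≰ (upper ⊤⁺
      (x , ⊤⁺ , 1≤∣x∣ , (λ t detects → never (t , detects)) , ≡.refl)))
    t : Carrier
    t = proj₁ first
    in-time : [ t / ∣ x ∣ ] ≤⁺ [ r ] → t ≤ r * z
    in-time NonStrict.[ t/∣x∣≤r ] = begin
      t                    ≈⟨ /-cancel (<-≤-trans 0<1 1≤∣x∣) ⟨
      ∣ x ∣ * (t / ∣ x ∣)  ≤⟨ ≤-by (≤-trans (inj₁ 0<1) 1≤∣x∣ *≤ x≤y⇒0≤y-x t/∣x∣≤r)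
                               (solve 3 (λ a q r → a :* r :- a :* q := a :* (r :- q)) refl ∣ x ∣ (t / ∣ x ∣) r) ⟩
      ∣ x ∣ * r            ≈⟨ *-congʳ ∣x∣≈z ⟩
      z * r                ≈⟨ *-comm z r ⟩
      r * z                ∎

-- The choice of the slack factor, and the contradiction.

theorem3 : ExcludedMiddle 0ℓ → (ℝ : CompleteOrderedField) →
  let open CompleteOrderedField ℝ
      open SquareRoot ℝ
  in
  (v : Carrier) → 0# < v → v < 1# →
  let open LinearSearch ℝ v in
  ¬ (∃[ A ] ∃[ ρ ] (IsCompetitiveRatio A ρ ×
       ρ <⁺ [ 3# + 2# * √ (2# + 2# / v) + 2# / v ]))
theorem3 em ℝ v 0<v v<1 (A , [ r₀ ] , (upper , _) , Strict.[ r₀<R ]) =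
  no-fast-detection 1<κ (inj₁ 0<r) detected 0≤σ σ²≈2c (≤-<-trans (inj₂ r*κ≈m) m<R′)
  where
  open CompleteOrderedField ℝ
  open OrderedField ℝ
  open SquareRoot ℝ
  open Sides ℝ
  open LinearSearch ℝ v
  open Trajectories ℝ v 0<v v<1 A
  open Phases em ℝ v 0<v v<1 A
  open DetectionTimes em ℝ v 0<v v<1 A
  open OrderReasoning

  σ R′ : Carrier
  σ = √ (2# + 2# / v)
  R′ = 1# + 2# * ((1# + w) + σ)

  0≤σ : 0# ≤ σ
  0≤σ = √-nonneg (2# + 2# / v)

  σ²≈2c : σ * σ ≈ 2# * (1# + w)
  σ²≈2c = trans (√-square (inj₁ 0<2 +≤ inj₁ 0<2 *≤ ≤-trans (inj₁ 0<1) 1≤w))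
    (solve 1 (λ w → (:1 :+ :1) :+ (:1 :+ :1) :* w := (:1 :+ :1) :* (:1 :+ w)) refl w)

  r₀<R′ : r₀ < R′
  r₀<R′ = <-≤-trans r₀<R (inj₂ (solve 2 (λ w s →
    (:1 :+ :1 :+ :1) :+ (:1 :+ :1) :* s :+ (:1 :+ :1) :* w := :1 :+ (:1 :+ :1) :* (:1 :+ w :+ s)) refl w σ))

  1<R′ : 1# < R′
  1<R′ = <-by (*-pos 0<2 (0≤σ +< (≤-trans (inj₁ 0<1) 1≤w +< 0<1)))
    (solve 2 (λ w s → (:1 :+ (:1 :+ :1) :* (:1 :+ w :+ s)) :- :1 := (:1 :+ :1) :* (s :+ (w :+ :1))) refl w σ)

  -- Division by the ratio requires it to be positive; a value below 1 is raised to 1, which is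
  -- still less than `R′`.
  positive-bound : ∃[ r ] (r₀ ≤ r × 0# < r × r < R′)
  positive-bound with r₀ <?≤ 1#
  ... | inj₁ r₀<1 = 1# , inj₁ r₀<1 , 0<1 , 1<R′
  ... | inj₂ 1≤r₀ = r₀ , ≤-refl , <-≤-trans 0<1 1≤r₀ , r₀<R′

  r m κ : Carrier
  r = proj₁ positive-bound
  m = proj₁ (dense (proj₂ (proj₂ (proj₂ positive-bound))))
  -- With `m` strictly between `r` and `R′`, the factor exceeds 1 while `r * κ ≈ m` stays below
  -- `R′`.
  κ = m / r

  r₀≤r : r₀ ≤ r
  r₀≤r = proj₁ (proj₂ positive-bound)

  0<r : 0# < r
  0<r = proj₁ (proj₂ (proj₂ positive-bound))

  r<m : r < m
  r<m = proj₁ (proj₂ (dense (proj₂ (proj₂ (proj₂ positive-bound)))))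

  m<R′ : m < R′
  m<R′ = proj₂ (proj₂ (dense (proj₂ (proj₂ (proj₂ positive-bound)))))

  r*κ≈m : r * κ ≈ m
  r*κ≈m = /-cancel 0<r

  1<κ : 1# < κ
  1<κ with 1# <?≤ κ
  ... | inj₁ 1<κ = 1<κ
  ... | inj₂ κ≤1 = ⊥-elim (<⇒≱ r<m (≤-trans (inj₂ (sym r*κ≈m)) (≤-by (inj₁ 0<r *≤ x≤y⇒0≤y-x κ≤1)
    (solve 2 (λ r k → r :- r :* k := r :* (:1 :- k)) refl r κ))))

  detected : ∀ e z → 1# ≤ z → ∃[ t ] (LinearSearch.DetectsAt ℝ v A (toward e z) t × t ≤ r * z)
  detected e z 1≤z =
    let t , detects , t≤r₀*z = detection-within-ratio upper e z 1≤z
    in t , detects , ≤-trans t≤r₀*z (≤-by (x≤y⇒0≤y-x r₀≤r *≤ ≤-trans (inj₁ 0<1) 1≤z)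
      (solve 3 (λ p r z → r :* z :- p :* z := (r :- p) :* z) refl r₀ r z))
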